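{- For $k\ge2$ and $1\le h\le\log k$, $$k\le\widehat{S}(\mathrm{TEP},h)\le\frac{2^{2^{h-1}+1}}{3}\cdot k.$$ In particular, $\widehat{S}(\mathrm{TEP},\log\log k)\le k^2/3$.
   Context: Logarithms base 2. Tree Evaluation Problem: $(\mathrm{TEP},1):[k]\to[k]$ is the identity; for $h\ge2$, $(\mathrm{TEP},h):[k]^{n_h}\to[k]$, $n_h=(2^{h-1}-1)k^2+2^{h-1}$, takes as input a complete binary tree of height $h$ (a root with two leaves has height 2) whose leaves carry values in $[k]$ and whose internal nodes carry matrices in $[k]^{k\times k}$ (each entry an input variable); a leaf's value is its label, an internal node with matrix $M$ has value $M(a,b)$ where $a,b$ are its children's values, and the output is the root's value. For $f:[k]^N\to R$ and $A\subseteq[N]$, $f_A$ is the $k^{|A|}\times k^{N-|A|}$ matrix with rows indexed by $\alpha\in[k]^A$, columns by assignments to the complement, entry the value of $f$; $\mathsf{mult}(f_A)$ is the number of occurrences of a most frequent row. $\widehat{S}(f)=\max_{1\le\ell\le N}\min_{A\subseteq[N],|A|=\ell}k^{\ell}/\mathsf{mult}(f_A)$. -}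

module Defs where

open import Data.Nat using (ℕ; zero; suc; _+_; _*_; _∸_; _^_; _⊔_; pred)
open import Data.Fin using (Fin; zero; suc; _↑ˡ_; _↑ʳ_; combine; _≟_)
open import Data.Fin.Subset using (Subset; inside; outside; ∣_∣; ∁)
open import Data.Vec using (Vec; []; _∷_; lookup)
open import Data.List using (List; []; _∷_; [_]; map; concatMap; allFin; filterᵇ; length; foldr; upTo)
open import Data.Bool.ListAction using (and)
open import Data.Bool using (Bool)
open import Data.Integer using (+_)
open import Data.Rational using (ℚ; _/_; 0ℚ)
import Data.Rational as ℚ
open import Relation.Nullary using (does)

-- Tree Evaluation Problem.
-- We index by d = h - 1 (so a tree of height h = d + 1).
-- Number of input variables of a tree of height d+1:
--   n 0 = 1,   n (d+1) = k^2 + 2 n d,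
-- which equals (2^(h-1) - 1) k^2 + 2^(h-1)  (see nTEP-formula below).

nVars : (k d : ℕ) → ℕ
nVars k zero    = 1
nVars k (suc d) = k * k + (nVars k d + nVars k d)

-- Input layout for height d+2: [ root matrix (k*k vars, entry (a,b) at
-- 'combine a b') | left subtree inputs | right subtree inputs ].
evalTree : (k d : ℕ) → (Fin (nVars k d) → Fin k) → Fin k
evalTree k zero    x = x zero
evalTree k (suc d) x =
  x (combine (evalTree k d left) (evalTree k d right) ↑ˡ (m + m))
  where
    m = nVars k d
    left : Fin m → Fin k
    left i = x ((k * k) ↑ʳ (i ↑ˡ m))
    right : Fin m → Fin k
    right i = x ((k * k) ↑ʳ (m ↑ʳ i))

-- (TEP, h) for h ≥ 1 (the value at h = 0 is irrelevant: it coincides with h = 1).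
nTEP : (k h : ℕ) → ℕ
nTEP k h = nVars k (h ∸ 1)

TEP : (k h : ℕ) → (Fin (nTEP k h) → Fin k) → Fin k
TEP k h = evalTree k (h ∸ 1)

vecsOver : {A : Set} → List A → (m : ℕ) → List (Vec A m)
vecsOver xs zero    = [ [] ]
vecsOver xs (suc m) = concatMap (λ x → map (x ∷_) (vecsOver xs m)) xs

allSubsets : (N : ℕ) → List (Subset N)
allSubsets N = vecsOver (outside ∷ inside ∷ []) N

subsetsOfSize : (N ℓ : ℕ) → List (Subset N)
subsetsOfSize N ℓ = filterᵇ (λ A → does (∣ A ∣ Data.Nat.≟ ℓ)) (allSubsets N)

merge : {X : Set} {N : ℕ} (A : Subset N) → Vec X ∣ A ∣ → Vec X ∣ ∁ A ∣ → Vec X N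
merge []            []       []       = []
merge (inside ∷ A)  (a ∷ as) bs       = a ∷ merge A as bs
merge (outside ∷ A) as       (b ∷ bs) = b ∷ merge A as bs

module _ {k N : ℕ} (f : (Fin N → Fin k) → Fin k) (A : Subset N) where

  rows : List (Vec (Fin k) ∣ A ∣)
  rows = vecsOver (allFin k) ∣ A ∣

  cols : List (Vec (Fin k) ∣ ∁ A ∣)
  cols = vecsOver (allFin k) ∣ ∁ A ∣

  entry : Vec (Fin k) ∣ A ∣ → Vec (Fin k) ∣ ∁ A ∣ → Fin k
  entry α c = f (lookup (merge A α c))

  sameRow : Vec (Fin k) ∣ A ∣ → Vec (Fin k) ∣ A ∣ → Bool
  sameRow α β = and (map (λ c → does (entry α c ≟ entry β c)) cols)

  occurrences : Vec (Fin k) ∣ A ∣ → ℕ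
  occurrences α = length (filterᵇ (sameRow α) rows)

  mult : ℕ
  mult = foldr (λ α m → occurrences α ⊔ m) 0 rows

maxℚ : List ℚ → ℚ
maxℚ []       = 0ℚ
maxℚ (q ∷ qs) = foldr ℚ._⊔_ q qs

minℚ : List ℚ → ℚ
minℚ []       = 0ℚ
minℚ (q ∷ qs) = foldr ℚ._⊓_ q qs

-- k^ℓ / mult(f_A).  mult(f_A) ≥ 1 whenever k ≥ 1 (every row occurs at least
-- once); 'suc (pred _)' only serves to make the denominator syntactically
-- nonzero and does not change its value in that case.
ratio : {k N : ℕ} → ((Fin N → Fin k) → Fin k) → Subset N → ℚ
ratio {k} f A = (+ (k ^ ∣ A ∣)) / suc (pred (mult f A))

Ŝ : {k N : ℕ} → ((Fin N → Fin k) → Fin k) → ℚ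
Ŝ {k} {N} f =
  maxℚ (map (λ ℓ → minℚ (map (ratio f) (subsetsOfSize N ℓ))) (map suc (upTo N)))

{-# OPTIONS --safe #-}
-- Multiplying by k ^ (N ∸ ∣A∣) turns the row count mult(f_A) into a count of full
-- assignments: it suffices to find, for every ℓ, a set A of size ℓ and a set of inputs of
-- density at least 1 / (k · 2 ^ (2 ^ (h - 1) - 1)) whose restrictions to A give equal rows.
-- Let m be the number of variables of a child subtree of the root.
--   ℓ ≤ m: recurse into the left subtree.
--   m ≤ ℓ ≤ m + k² - k: A is the left subtree together with entries of the root matrix
--     outside row 0; the inputs are those whose left value is 0.
--   Otherwise fewer than m + k variables are left out of A. As 2 ^ h ≤ k, they can be spread
--     over the matrices so that each loses at most half of its entries, and A then determines
--     the root value to be 0 with probability at least (1 / k) · ∏ (1 / 2).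
-- For the lower bound take ℓ = N: the value is uniformly distributed, so the ratio is k.
module Submission where

open import Defs
open import Data.Nat using (ℕ; zero; suc; pred; _≤_; _<_; _^_; _∸_; _+_; _*_; _⊔_; ⌊_/2⌋; ⌈_/2⌉; NonZero; z≤n; s≤s)
open import Data.Nat.Properties hiding (_≟_)
open import Data.Nat.Tactic.RingSolver using (solve-∀)
open import Data.Integer using (+_)
open import Data.Rational using (ℚ; _/_; 0ℚ; toℚᵘ; fromℚᵘ) renaming (_≤_ to _≤ℚ_; _*_ to _*ℚ_; _⊔_ to _⊔ℚ_; _⊓_ to _⊓ℚ_)
open import Data.Product using (_×_; _,_; ∃; ∃₂; proj₂)
open import Relation.Binary.PropositionalEquality
open import Algebra.Properties.Semiring.Sum +-*-semiring using (sum; sum-cong-≗; ∑-comm; *-distribˡ-sum; *-distribʳ-sum)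
open import Data.Bool using (Bool; true; false; _∧_; if_then_else_)
open import Data.Bool.ListAction using (and)
open import Data.Fin using (Fin; zero; suc; _≟_; combine; _↑ˡ_; _↑ʳ_)
open import Data.Fin.Subset using (Subset; inside; outside; ∣_∣; ∁; ⊤; ⊥)
open import Data.Fin.Subset.Properties using (∣⊤∣≡n; ∣⊥∣≡0; ∣p∣≤n; ∣∁p∣≡n∸∣p∣)
import Data.Integer as ℤ
open import Data.Integer.Properties using (pos-*)
open import Data.List as List using (List; []; _∷_; filterᵇ; length; concatMap; allFin; tabulate; foldr; upTo)
open import Data.List.Membership.Propositional using (_∈_)
open import Data.List.Membership.Propositional.Properties using (∈-map⁺; ∈-map⁻; ∈-concatMap⁺; ∈-allFin; ∈-filter⁺; ∈-filter⁻; ∈-upTo⁺; ∈-upTo⁻)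
import Data.List.Properties as List
open import Data.List.Relation.Unary.Any as Any using (here; there)
import Data.Rational.Properties as ℚ
import Data.Rational.Unnormalised as ℚᵘ
import Data.Rational.Unnormalised.Properties as ℚᵘ
open import Data.Sum using (_⊎_; inj₁; inj₂)
open import Data.Unit using (tt) renaming (⊤ to Unit)
open import Data.Vec as Vec using (Vec; []; _∷_; _++_; lookup; take; drop)
open import Data.Vec.Properties using (lookup-++ˡ; lookup-++ʳ; take++drop≡id; lookup-replicate)
open import Function using (_∘_)
open import Relation.Nullary using (does; yes; no; contradiction)
open import Relation.Nullary.Decidable using (dec-true)

private variable
  k m n : ℕ
  X : Set

-- Sums over Fin and over vectors

⟦_⟧ : Bool → ℕ
⟦ b ⟧ = if b then 1 else 0

⟦⟧-∧ : ∀ a b → ⟦ a ∧ b ⟧ ≡ ⟦ a ⟧ * ⟦ b ⟧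
⟦⟧-∧ true  b = sym (+-identityʳ _)
⟦⟧-∧ false b = refl

δ : Fin k → Fin k → ℕ
δ i j = ⟦ does (i ≟ j) ⟧

δ-comm : ∀ (i j : Fin n) → δ i j ≡ δ j i
δ-comm zero    zero    = refl
δ-comm zero    (suc j) = refl
δ-comm (suc i) zero    = refl
δ-comm (suc i) (suc j) = δ-comm i j

sum-const : ∀ n c → sum {n} (λ _ → c) ≡ n * c
sum-const zero    c = refl
sum-const (suc n) c = cong (λ w → c + w) (sum-const n c)

sum-mono : {f g : Fin n → ℕ} → (∀ i → f i ≤ g i) → sum f ≤ sum g
sum-mono {n = zero}  f≤g = z≤n
sum-mono {n = suc n} f≤g = +-mono-≤ (f≤g zero) (sum-mono (f≤g ∘ suc))

sum-zero⊎pos : (f : Fin n → ℕ) → sum f ≡ 0 ⊎ ∃ λ i → 0 < f i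
sum-zero⊎pos {n = zero}  f = inj₁ refl
sum-zero⊎pos {n = suc n} f with f zero in eq | sum-zero⊎pos (f ∘ suc)
... | zero  | inj₁ e       = inj₁ e
... | zero  | inj₂ (i , p) = inj₂ (suc i , p)
... | suc _ | _            = inj₂ (zero , subst (0 <_) (sym eq) (s≤s z≤n))

sum-++ : ∀ m (f : Fin (m + n) → ℕ) → sum f ≡ sum (λ i → f (i ↑ˡ n)) + sum (λ j → f (m ↑ʳ j))
sum-++ zero    f = refl
sum-++ (suc m) f = trans (cong (λ w → f zero + w) (sum-++ m (f ∘ suc))) (sym (+-assoc (f zero) _ _))

sum-combine : ∀ m (f : Fin (m * n) → ℕ) → sum f ≡ sum (λ i → sum (λ j → f (combine {m} {n} i j)))
sum-combine         zero    f = refl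
sum-combine {n = n} (suc m) f = trans (sum-++ n f) (cong (λ w → sum (λ j → f (combine {suc m} zero j)) + w) (sum-combine m (λ i → f (n ↑ʳ i))))


sum-δ : ∀ (i : Fin n) (f : Fin n → ℕ) → sum (λ j → δ i j * f j) ≡ f i
sum-δ {n = suc n} zero    f =
  trans (cong₂ _+_ (+-identityʳ (f zero)) (trans (sum-const n 0) (*-zeroʳ n))) (+-identityʳ _)
sum-δ {n = suc n} (suc i) f = sum-δ i (f ∘ suc)

∣∣≡sum : (B : Subset n) → ∣ B ∣ ≡ sum (λ i → ⟦ lookup B i ⟧)
∣∣≡sum []            = refl
∣∣≡sum (inside  ∷ B) = cong suc (∣∣≡sum B)
∣∣≡sum (outside ∷ B) = ∣∣≡sum B

∣++∣ : (A : Subset m) (B : Subset n) → ∣ A ++ B ∣ ≡ ∣ A ∣ + ∣ B ∣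
∣++∣ []            B = refl
∣++∣ (inside  ∷ A) B = cong suc (∣++∣ A B)
∣++∣ (outside ∷ A) B = ∣++∣ A B

-- Counts of inputs, hence probabilities up to the factor `k ^ n`. Peeling off one coordinate at a
-- time matches `vecsOver` and `merge`.
sumᵛ : ∀ n → (Vec (Fin k) n → ℕ) → ℕ
sumᵛ zero    g = g []
sumᵛ (suc n) g = sum (λ a → sumᵛ n (g ∘ (a ∷_)))

sumᵛ-cong : ∀ n {f g : Vec (Fin k) n → ℕ} → (∀ x → f x ≡ g x) → sumᵛ n f ≡ sumᵛ n g
sumᵛ-cong zero    e = e []
sumᵛ-cong (suc n) e = sum-cong-≗ (λ a → sumᵛ-cong n (e ∘ (a ∷_)))

sumᵛ-mono : ∀ n {f g : Vec (Fin k) n → ℕ} → (∀ x → f x ≤ g x) → sumᵛ n f ≤ sumᵛ n g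
sumᵛ-mono zero    e = e []
sumᵛ-mono (suc n) e = sum-mono (λ a → sumᵛ-mono n (e ∘ (a ∷_)))

sumᵛ-const : ∀ n c → sumᵛ {k} n (λ _ → c) ≡ k ^ n * c
sumᵛ-const         zero    c = sym (+-identityʳ c)
sumᵛ-const {k = k} (suc n) c = begin
  sum {k} (λ _ → sumᵛ {k} n (λ _ → c)) ≡⟨ sum-const k _ ⟩
  k * sumᵛ {k} n (λ _ → c)             ≡⟨ cong (k *_) (sumᵛ-const n c) ⟩
  k * (k ^ n * c)                      ≡⟨ *-assoc k (k ^ n) c ⟨
  k * k ^ n * c                        ∎
  where open ≡-Reasoning

sumᵛ-*ˡ : ∀ n c (g : Vec (Fin k) n → ℕ) → sumᵛ n (λ x → c * g x) ≡ c * sumᵛ n g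
sumᵛ-*ˡ zero    c g = refl
sumᵛ-*ˡ (suc n) c g =
  trans (sum-cong-≗ (λ a → sumᵛ-*ˡ n c (g ∘ (a ∷_)))) (sym (*-distribˡ-sum c (λ a → sumᵛ n (g ∘ (a ∷_)))))

sumᵛ-*ʳ : ∀ n c (g : Vec (Fin k) n → ℕ) → sumᵛ n (λ x → g x * c) ≡ sumᵛ n g * c
sumᵛ-*ʳ zero    c g = refl
sumᵛ-*ʳ (suc n) c g =
  trans (sum-cong-≗ (λ a → sumᵛ-*ʳ n c (g ∘ (a ∷_)))) (sym (*-distribʳ-sum c (λ a → sumᵛ n (g ∘ (a ∷_)))))

sumᵛ-sum : ∀ n (g : Fin m → Vec (Fin k) n → ℕ) →
  sumᵛ n (λ x → sum (λ i → g i x)) ≡ sum (λ i → sumᵛ n (g i))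
sumᵛ-sum zero    g = refl
sumᵛ-sum (suc n) g =
  trans (sum-cong-≗ (λ a → sumᵛ-sum n (λ i → g i ∘ (a ∷_))))
        (∑-comm (λ a i → sumᵛ n (g i ∘ (a ∷_))))

sumᵛ-++ : ∀ m (g : Vec (Fin k) (m + n) → ℕ) →
  sumᵛ (m + n) g ≡ sumᵛ m (λ x → sumᵛ n (λ y → g (x ++ y)))
sumᵛ-++ zero    g = refl
sumᵛ-++ (suc m) g = sum-cong-≗ (λ a → sumᵛ-++ m (g ∘ (a ∷_)))

sumᵛ-zero⊎pos : ∀ n (g : Vec (Fin k) n → ℕ) → sumᵛ n g ≡ 0 ⊎ ∃ λ x → 0 < g x
sumᵛ-zero⊎pos zero    g with g [] in eq
... | zero  = inj₁ refl
... | suc _ = inj₂ ([] , subst (0 <_) (sym eq) (s≤s z≤n))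
sumᵛ-zero⊎pos (suc n) g with sum-zero⊎pos (λ a → sumᵛ n (g ∘ (a ∷_)))
... | inj₁ e       = inj₁ e
... | inj₂ (a , p) with sumᵛ-zero⊎pos n (g ∘ (a ∷_))
...   | inj₁ e       = contradiction e (m<n⇒n≢0 p)
...   | inj₂ (x , q) = inj₂ (a ∷ x , q)

-- One coordinate of a uniformly random vector is uniform. Probabilities are cleared of denominators
-- here and below.
sumᵛ-lookup : ∀ (i : Fin n) (v : Fin k) → sumᵛ n (λ x → δ (lookup x i) v) * k ≡ k ^ n
sumᵛ-lookup {n = suc n} {k = k} zero v = begin
  sum (λ a → sumᵛ n (λ _ → δ a v)) * k ≡⟨ cong (_* k) (sum-cong-≗ λ a → trans (sumᵛ-const n (δ a v)) (trans (*-comm (k ^ n) _) (cong (_* k ^ n) (δ-comm a v)))) ⟩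
  sum (λ a → δ v a * k ^ n) * k        ≡⟨ cong (_* k) (sum-δ v (λ _ → k ^ n)) ⟩
  k ^ n * k                            ≡⟨ *-comm (k ^ n) k ⟩
  k * k ^ n                            ∎
  where
  open ≡-Reasoning
sumᵛ-lookup {n = suc n} {k = k} (suc i) v =
  trans (cong (_* k) (sum-const k _)) (trans (*-assoc k _ k) (cong (k *_) (sumᵛ-lookup i v)))

-- Independence of the root matrix and the two subtrees: each factor depends on one block only, so
-- the sums separate.
sumᵛ-product : ∀ m n o c (f : Vec (Fin k) n → ℕ) (g : Vec (Fin k) o → ℕ) (h : Vec (Fin k) m → ℕ) →
  sumᵛ m (λ M → sumᵛ n (λ L → sumᵛ o (λ R → f L * (g R * (c * h M)))))
    ≡ sumᵛ n f * (sumᵛ o g * (c * sumᵛ m h))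
sumᵛ-product m n o c f g h = begin
  sumᵛ m (λ M → sumᵛ n (λ L → sumᵛ o (λ R → f L * (g R * (c * h M)))))
    ≡⟨ sumᵛ-cong m (λ M → sumᵛ-cong n λ L → trans (sumᵛ-*ˡ o (f L) _) (cong (f L *_) (sumᵛ-*ʳ o _ g))) ⟩
  sumᵛ m (λ M → sumᵛ n (λ L → f L * (sumᵛ o g * (c * h M))))
    ≡⟨ sumᵛ-cong m (λ M → sumᵛ-*ʳ n _ f) ⟩
  sumᵛ m (λ M → sumᵛ n f * (sumᵛ o g * (c * h M)))
    ≡⟨ trans (sumᵛ-*ˡ m (sumᵛ n f) (λ M → sumᵛ o g * (c * h M)))
         (cong (sumᵛ n f *_) (trans (sumᵛ-*ˡ m (sumᵛ o g) (λ M → c * h M)) (cong (sumᵛ o g *_) (sumᵛ-*ˡ m c h)))) ⟩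
  sumᵛ n f * (sumᵛ o g * (c * sumᵛ m h)) ∎
  where open ≡-Reasoning

-- Lengths of filtered lists as sums

length-filterᵇ-concatMap-tabulate : ∀ {Y : Set} (p : Y → Bool) (f : X → List Y) (h : Fin n → X) →
  length (filterᵇ p (concatMap f (tabulate h))) ≡ sum (λ i → length (filterᵇ p (f (h i))))
length-filterᵇ-concatMap-tabulate {n = zero}  p f h = refl
length-filterᵇ-concatMap-tabulate {n = suc n} p f h = begin
  length (filterᵇ p (f (h zero) List.++ concatMap f (tabulate (h ∘ suc))))
    ≡⟨ cong length (List.filter-++ _ (f (h zero)) _) ⟩
  length (filterᵇ p (f (h zero)) List.++ filterᵇ p (concatMap f (tabulate (h ∘ suc))))
    ≡⟨ List.length-++ (filterᵇ p (f (h zero))) ⟩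
  length (filterᵇ p (f (h zero))) + length (filterᵇ p (concatMap f (tabulate (h ∘ suc))))
    ≡⟨ cong (λ w → length (filterᵇ p (f (h zero))) + w) (length-filterᵇ-concatMap-tabulate p f (h ∘ suc)) ⟩
  sum (λ i → length (filterᵇ p (f (h i)))) ∎
  where open ≡-Reasoning

length-filterᵇ-map : ∀ {Y : Set} (p : Y → Bool) (f : X → Y) xs →
  length (filterᵇ p (List.map f xs)) ≡ length (filterᵇ (p ∘ f) xs)
length-filterᵇ-map p f []       = refl
length-filterᵇ-map p f (x ∷ xs) with p (f x)
... | true  = cong suc (length-filterᵇ-map p f xs)
... | false = length-filterᵇ-map p f xs

length-filterᵇ-vecsOver : ∀ n (p : Vec (Fin k) n → Bool) →
  length (filterᵇ p (vecsOver (allFin k) n)) ≡ sumᵛ n (⟦_⟧ ∘ p)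
length-filterᵇ-vecsOver zero p with p []
... | true  = refl
... | false = refl
length-filterᵇ-vecsOver (suc n) p =
  trans (length-filterᵇ-concatMap-tabulate p (λ a → List.map (a ∷_) (vecsOver (allFin _) n)) (λ i → i))
        (sum-cong-≗ λ a → trans (length-filterᵇ-map p (a ∷_) (vecsOver (allFin _) n))
                                (length-filterᵇ-vecsOver n (p ∘ (a ∷_))))

-- Rows of f_A and densities of full assignments

∈-vecsOver : {xs : List X} → (∀ x → x ∈ xs) → (v : Vec X m) → v ∈ vecsOver xs m
∈-vecsOver all []       = here refl
∈-vecsOver all (x ∷ v) =
  ∈-concatMap⁺ _ (Any.map (λ { refl → ∈-map⁺ (x ∷_) (∈-vecsOver all v) }) (all x))

and-map-true : (p : X → Bool) → (∀ x → p x ≡ true) → ∀ xs → and (List.map p xs) ≡ true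
and-map-true p all []       = refl
and-map-true p all (x ∷ xs) rewrite all x = and-map-true p all xs

and-map-∈ : (p : X → Bool) {xs : List X} {x : X} → x ∈ xs → and (List.map p xs) ≡ true → p x ≡ true
and-map-∈ p {x ∷ xs} (here refl) e with p x
... | true = refl
and-map-∈ p {y ∷ xs} (there i) e with p y
... | true = and-map-∈ p i e

⟦⟧-mono : ∀ {a b} → (a ≡ true → b ≡ true) → ⟦ a ⟧ ≤ ⟦ b ⟧
⟦⟧-mono {false}        f = z≤n
⟦⟧-mono {true} {true}  f = s≤s z≤n
⟦⟧-mono {true} {false} f with () ← f refl

⟦⟧-pos : ∀ {a} → 0 < ⟦ a ⟧ → a ≡ true
⟦⟧-pos {true} _ = refl

⊔-foldr-upper : (g : X → ℕ) {xs : List X} {x : X} → x ∈ xs → g x ≤ foldr (λ y m → g y ⊔ m) 0 xs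
⊔-foldr-upper g (here refl) = m≤m⊔n _ _
⊔-foldr-upper g {y ∷ _} (there i) = ≤-trans (⊔-foldr-upper g i) (m≤n⊔m (g y) _)

⊔-foldr-least : (g : X → ℕ) {c : ℕ} → (∀ x → g x ≤ c) → ∀ xs → foldr (λ y m → g y ⊔ m) 0 xs ≤ c
⊔-foldr-least g g≤c []       = z≤n
⊔-foldr-least g g≤c (x ∷ xs) = ⊔-lub (g≤c x) (⊔-foldr-least g g≤c xs)

-- Unlike `merge`, this keeps both arguments at full length, so it is compatible with `_++_` and can
-- be followed down a tree.
overwrite : Subset n → Vec X n → Vec X n → Vec X n
overwrite []            []       []       = []
overwrite (inside  ∷ A) (x ∷ xs) (c ∷ cs) = x ∷ overwrite A xs cs
overwrite (outside ∷ A) (x ∷ xs) (c ∷ cs) = c ∷ overwrite A xs cs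

overwrite-merge : ∀ (A : Subset n) (α : Vec X _) β γ c →
  overwrite A (merge A α β) (merge A γ c) ≡ merge A α c
overwrite-merge []            []      []      []      []      = refl
overwrite-merge (inside  ∷ A) (a ∷ α) β       (_ ∷ γ) c       = cong (a ∷_) (overwrite-merge A α β γ c)
overwrite-merge (outside ∷ A) α       (_ ∷ β) γ       (x ∷ c) = cong (x ∷_) (overwrite-merge A α β γ c)

merge-surjective : ∀ (A : Subset n) (x : Vec X n) → ∃₂ λ α β → merge A α β ≡ x
merge-surjective []            []      = [] , [] , refl
merge-surjective (inside  ∷ A) (a ∷ x) with α , β , e ← merge-surjective A x = a ∷ α , β , cong (a ∷_) e
merge-surjective (outside ∷ A) (a ∷ x) with α , β , e ← merge-surjective A x = α , a ∷ β , cong (a ∷_) e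

overwrite-++ : (A : Subset m) (B : Subset n) (x c : Vec X m) (y d : Vec X n) →
  overwrite (A ++ B) (x ++ y) (c ++ d) ≡ overwrite A x c ++ overwrite B y d
overwrite-++ []            B []      []      y d = refl
overwrite-++ (inside  ∷ A) B (a ∷ x) (_ ∷ c) y d = cong (a ∷_) (overwrite-++ A B x c y d)
overwrite-++ (outside ∷ A) B (_ ∷ x) (a ∷ c) y d = cong (a ∷_) (overwrite-++ A B x c y d)

overwrite-⊤ : (x c : Vec X n) → overwrite ⊤ x c ≡ x
overwrite-⊤ []      []      = refl
overwrite-⊤ (a ∷ x) (_ ∷ c) = cong (a ∷_) (overwrite-⊤ x c)

overwrite-⊥ : (x c : Vec X n) → overwrite ⊥ x c ≡ c
overwrite-⊥ []      []      = refl
overwrite-⊥ (_ ∷ x) (a ∷ c) = cong (a ∷_) (overwrite-⊥ x c)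

lookup-overwrite : (A : Subset n) (x c : Vec X n) (i : Fin n) →
  lookup (overwrite A x c) i ≡ (if lookup A i then lookup x i else lookup c i)
lookup-overwrite (inside  ∷ A) (_ ∷ _) (_ ∷ _) zero    = refl
lookup-overwrite (outside ∷ A) (_ ∷ _) (_ ∷ _) zero    = refl
lookup-overwrite (inside  ∷ A) (_ ∷ x) (_ ∷ c) (suc i) = lookup-overwrite A x c i
lookup-overwrite (outside ∷ A) (_ ∷ x) (_ ∷ c) (suc i) = lookup-overwrite A x c i

sumᵛ-merge : ∀ (A : Subset n) (g : Vec (Fin k) n → ℕ) →
  sumᵛ n g ≡ sumᵛ ∣ A ∣ (λ α → sumᵛ ∣ ∁ A ∣ (λ β → g (merge A α β)))
sumᵛ-merge []            g = refl
sumᵛ-merge (inside  ∷ A) g = sum-cong-≗ (λ a → sumᵛ-merge A (g ∘ (a ∷_)))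
sumᵛ-merge (outside ∷ A) g =
  trans (sum-cong-≗ (λ a → sumᵛ-merge A (g ∘ (a ∷_))))
        (sym (sumᵛ-sum ∣ A ∣ (λ a α → sumᵛ ∣ ∁ A ∣ (λ β → g (a ∷ merge A α β)))))

∣p∣+∣∁p∣≡n : (A : Subset n) → ∣ A ∣ + ∣ ∁ A ∣ ≡ n
∣p∣+∣∁p∣≡n A = trans (cong (λ w → ∣ A ∣ + w) (∣∁p∣≡n∸∣p∣ A)) (m+[n∸m]≡n (∣p∣≤n A))

-- Since k ^ N = k ^ ∣A∣ · k ^ ∣∁A∣, a set of assignments of density at least 1 / D
-- whose restrictions to A all induce the same row yields mult(f_A) ≥ k ^ ∣A∣ / D.
record EqualRows {k N : ℕ} (f : (Fin N → Fin k) → Fin k) (ℓ D : ℕ) : Set where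
  field
    A       : Subset N
    size    : ∣ A ∣ ≡ ℓ
    Q       : Vec (Fin k) N → Bool
    row     : Vec (Fin k) N → Fin k
    row-eq  : ∀ x c → Q x ≡ true → f (lookup (overwrite A x c)) ≡ row c
    density : k ^ N ≤ sumᵛ N (⟦_⟧ ∘ Q) * D

module _ {k N : ℕ} {f : (Fin N → Fin k) → Fin k} where

  occurrences≤mult : (A : Subset N) (α : Vec (Fin k) ∣ A ∣) → occurrences f A α ≤ mult f A
  occurrences≤mult A α = ⊔-foldr-upper (occurrences f A) (∈-vecsOver ∈-allFin α)

  -- Any one assignment in `Q` fixes a row `α₀`. All assignments in `Q` restrict to copies of this
  -- row, and each copy extends to only `k ^ ∣ ∁ A ∣` assignments, so `Q` has at most
  -- `occurrences f A α₀ * k ^ ∣ ∁ A ∣` elements.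
  mult-lower-bound : ∀ {ℓ D} .{{_ : NonZero k}} (e : EqualRows f ℓ D) →
    k ^ ∣ EqualRows.A e ∣ ≤ mult f (EqualRows.A e) * D
  mult-lower-bound {ℓ} {D} e with sumᵛ-zero⊎pos N (⟦_⟧ ∘ EqualRows.Q e)
  -- An empty `Q` would give `k ^ N ≤ 0` by the density condition.
  ... | inj₁ sum≡0 = contradiction
          (subst (λ s → k ^ N ≤ s * D) sum≡0 (EqualRows.density e))
          (<⇒≱ (m^n>0 k N))
  ... | inj₂ (x₀ , Qx₀) with α₀ , β₀ , refl ← merge-surjective (EqualRows.A e) x₀ =
    *-cancelʳ-≤ (k ^ |A|) (mult f A * D) (k ^ |∁A|) {{m^n≢0 k |∁A|}} (begin
      k ^ |A| * k ^ |∁A|                  ≡⟨ ^-distribˡ-+-* k |A| |∁A| ⟨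
      k ^ (|A| + |∁A|)                    ≡⟨ cong (k ^_) (∣p∣+∣∁p∣≡n A) ⟩
      k ^ N                                    ≤⟨ density ⟩
      sumᵛ N (⟦_⟧ ∘ Q) * D                     ≤⟨ *-monoˡ-≤ D sum≤ ⟩
      occurrences f A α₀ * k ^ |∁A| * D     ≤⟨ *-monoˡ-≤ D (*-monoˡ-≤ (k ^ |∁A|) (occurrences≤mult A α₀)) ⟩
      mult f A * k ^ |∁A| * D               ≡⟨ swap (mult f A) (k ^ |∁A|) D ⟩
      mult f A * D * k ^ |∁A|               ∎)
    where
    open EqualRows e
    |A| = ∣ A ∣
    |∁A| = ∣ ∁ A ∣
    open ≤-Reasoning
    swap : ∀ a b c → a * b * c ≡ a * c * b
    swap = solve-∀

    entry≡row : ∀ α β c → Q (merge A α β) ≡ true → entry f A α c ≡ row (merge A α₀ c)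
    entry≡row α β c q =
      -- The column `c` is padded on `A` with the fixed `α₀`, so that the value of `row` is the same
      -- for every `α`.
      trans (cong (f ∘ lookup) (sym (overwrite-merge A α β α₀ c))) (row-eq _ _ q)

    sameRow-true : ∀ α β → Q (merge A α β) ≡ true → sameRow f A α₀ α ≡ true
    sameRow-true α β q = and-map-true _
      (λ c → dec-true (_ ≟ _) (trans (entry≡row α₀ β₀ c (⟦⟧-pos Qx₀)) (sym (entry≡row α β c q))))
      (cols f A)

    sum≤ : sumᵛ N (⟦_⟧ ∘ Q) ≤ occurrences f A α₀ * k ^ |∁A|
    sum≤ = begin
      sumᵛ N (⟦_⟧ ∘ Q)
        ≡⟨ sumᵛ-merge A _ ⟩
      sumᵛ |A| (λ α → sumᵛ |∁A| (λ β → ⟦ Q (merge A α β) ⟧))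
        ≤⟨ sumᵛ-mono |A| (λ α → sumᵛ-mono |∁A| (λ β → ⟦⟧-mono (sameRow-true α β))) ⟩
      sumᵛ |A| (λ α → sumᵛ {k} |∁A| (λ β → ⟦ sameRow f A α₀ α ⟧))
        ≡⟨ sumᵛ-cong |A| (λ α → trans (sumᵛ-const {k} |∁A| _) (*-comm (k ^ |∁A|) _)) ⟩
      sumᵛ |A| (λ α → ⟦ sameRow f A α₀ α ⟧ * k ^ |∁A|)
        ≡⟨ sumᵛ-*ʳ |A| (k ^ |∁A|) _ ⟩
      sumᵛ |A| (⟦_⟧ ∘ sameRow f A α₀) * k ^ |∁A|
        ≡⟨ cong (_* k ^ |∁A|) (length-filterᵇ-vecsOver |A| (sameRow f A α₀)) ⟨
      occurrences f A α₀ * k ^ |∁A| ∎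

  -- For `∣ A ∣ = N` there is a single, empty column, so equal rows mean equal values and
  -- `occurrences` counts a fibre of `f`.
  mult-upper-bound : ∀ {c} (A : Subset N) → ∣ A ∣ ≡ N →
    (∀ v → sumᵛ N (λ x → δ v (f (lookup x))) ≤ c) → mult f A ≤ c
  mult-upper-bound {c} A ∣A∣≡N bound = ⊔-foldr-least (occurrences f A) occ≤ (rows f A)
    where
    open ≤-Reasoning
    |A| = ∣ A ∣
    |∁A| = ∣ ∁ A ∣
    ∣∁A∣≡0 : |∁A| ≡ 0
    ∣∁A∣≡0 = trans (∣∁p∣≡n∸∣p∣ A) (trans (cong (N ∸_) ∣A∣≡N) (n∸n≡0 N))

    β₀ : Vec (Fin k) |∁A|
    β₀ = Vec.cast (sym ∣∁A∣≡0) []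

    sumᵛ-empty : ∀ {m} → m ≡ 0 → (β : Vec (Fin k) m) (g : Vec (Fin k) m → ℕ) → g β ≡ sumᵛ m g
    sumᵛ-empty refl [] g = refl

    occ≤ : ∀ α → occurrences f A α ≤ c
    occ≤ α = begin
      occurrences f A α
        ≡⟨ length-filterᵇ-vecsOver |A| (sameRow f A α) ⟩
      sumᵛ |A| (⟦_⟧ ∘ sameRow f A α)
        ≤⟨ sumᵛ-mono |A| (λ α′ → ⟦⟧-mono (and-map-∈ _ (∈-vecsOver ∈-allFin β₀))) ⟩
      sumᵛ |A| (λ α′ → δ (entry f A α β₀) (entry f A α′ β₀))
        ≡⟨ sumᵛ-cong |A| (λ α′ → sumᵛ-empty ∣∁A∣≡0 β₀ _) ⟩
      sumᵛ |A| (λ α′ → sumᵛ |∁A| (λ β → δ (entry f A α β₀) (entry f A α′ β)))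
        ≡⟨ sumᵛ-merge A _ ⟨
      sumᵛ N (λ x → δ (entry f A α β₀) (f (lookup x)))
        ≤⟨ bound (entry f A α β₀) ⟩
      c ∎

-- Evaluation of trees whose matrices are partially known

take-++ : (x : Vec X m) (y : Vec X n) → take m (x ++ y) ≡ x
take-++ []      y = refl
take-++ (a ∷ x) y = cong (a ∷_) (take-++ x y)

drop-++ : (x : Vec X m) (y : Vec X n) → drop m (x ++ y) ≡ y
drop-++ []      y = refl
drop-++ (a ∷ x) y = drop-++ x y

∧-true : ∀ {a b} → a ∧ b ≡ true → a ≡ true × b ≡ true
∧-true {true} {true} _ = refl , refl

does⇒≡ : ∀ {i j : Fin n} → does (i ≟ j) ≡ true → i ≡ j
does⇒≡ {i = i} {j} e with yes p ← i ≟ j = p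

-- Only internal nodes are counted: `2 ^ d - 1` in a tree of height `d + 1`.
nodes : ℕ → ℕ
nodes zero    = 0
nodes (suc d) = suc (nodes d + nodes d)

suc-nodes : ∀ d → suc (nodes d) ≡ 2 ^ d
suc-nodes zero    = refl
suc-nodes (suc d) = trans (double (nodes d)) (cong (2 *_) (suc-nodes d))
  where
  double : ∀ n → 2 + (n + n) ≡ 2 * suc n
  double = solve-∀

nVars≡ : ∀ k d → nVars k d ≡ nodes d * (k * k) + suc (nodes d)
nVars≡ k zero    = refl
nVars≡ k (suc d) =
  trans (cong (λ n → k * k + (n + n)) (nVars≡ k d)) (regroup (nodes d) (k * k))
  where
  regroup : ∀ n s → s + ((n * s + suc n) + (n * s + suc n)) ≡ suc (n + n) * s + suc (suc (n + n))
  regroup = solve-∀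

module _ {k : ℕ} where

  eval : ∀ d → Vec (Fin k) (nVars k d) → Fin k
  eval d x = evalTree k d (lookup x)

  evalTree-cong : ∀ d {x y : Fin (nVars k d) → Fin k} → (∀ i → x i ≡ y i) →
    evalTree k d x ≡ evalTree k d y
  evalTree-cong zero    e = e zero
  evalTree-cong (suc d) {x} {y} e = trans (e _) (cong (λ i → y (i ↑ˡ _))
    (cong₂ combine (evalTree-cong d (λ i → e _)) (evalTree-cong d (λ i → e _))))

  eval-node : ∀ d (M : Vec (Fin k) (k * k)) (L R : Vec (Fin k) (nVars k d)) →
    eval (suc d) (M ++ (L ++ R)) ≡ lookup M (combine (eval d L) (eval d R))
  eval-node d M L R = trans (lookup-++ˡ M (L ++ R) _) (cong (lookup M) (cong₂ combine
    (evalTree-cong d (λ i → trans (lookup-++ʳ M (L ++ R) _) (lookup-++ˡ L R i)))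
    (evalTree-cong d (λ i → trans (lookup-++ʳ M (L ++ R) _) (lookup-++ʳ L R i)))))

  mat : ∀ d → Vec X (nVars k (suc d)) → Vec X (k * k)
  mat d x = take (k * k) x

  left right : ∀ d → Vec X (nVars k (suc d)) → Vec X (nVars k d)
  left  d x = take (nVars k d) (drop (k * k) x)
  right d x = drop (nVars k d) (drop (k * k) x)

  node-η : ∀ d (x : Vec X (nVars k (suc d))) → mat d x ++ (left d x ++ right d x) ≡ x
  node-η d x = trans (cong (mat d x ++_) (take++drop≡id (nVars k d) (drop (k * k) x)))
                     (take++drop≡id (k * k) x)

  left-++ : ∀ d (M : Vec X (k * k)) (L R : Vec X (nVars k d)) → left d (M ++ (L ++ R)) ≡ L
  left-++ d M L R = trans (cong (take _) (drop-++ M (L ++ R))) (take-++ L R)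

  right-++ : ∀ d (M : Vec X (k * k)) (L R : Vec X (nVars k d)) → right d (M ++ (L ++ R)) ≡ R
  right-++ d M L R = trans (cong (drop (nVars k d)) (drop-++ M (L ++ R))) (drop-++ L R)

  -- Overwriting acts separately on the root matrix and on both subtrees. Equality of rows is
  -- verified at each node through this identity.
  eval-overwrite : ∀ d (B : Subset (k * k)) (Al Ar : Subset (nVars k d))
    (x c : Vec (Fin k) (nVars k (suc d))) →
    eval (suc d) (overwrite (B ++ (Al ++ Ar)) x c)
      ≡ lookup (overwrite B (mat d x) (mat d c))
               (combine (eval d (overwrite Al (left d x) (left d c)))
                        (eval d (overwrite Ar (right d x) (right d c))))
  eval-overwrite d B Al Ar x c = begin
    eval (suc d) (overwrite (B ++ (Al ++ Ar)) x c)
      ≡⟨ cong (eval (suc d)) (cong₂ (overwrite (B ++ (Al ++ Ar))) (node-η d x) (node-η d c)) ⟨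
    eval (suc d) (overwrite (B ++ (Al ++ Ar)) (mat d x ++ (left d x ++ right d x)) (mat d c ++ (left d c ++ right d c)))
      ≡⟨ cong (eval (suc d)) (trans (overwrite-++ B _ (mat d x) (mat d c) _ _)
           (cong (overwrite B (mat d x) (mat d c) ++_) (overwrite-++ Al Ar (left d x) (left d c) _ _))) ⟩
    eval (suc d) (overwrite B (mat d x) (mat d c) ++
      (overwrite Al (left d x) (left d c) ++ overwrite Ar (right d x) (right d c)))
      ≡⟨ eval-node d (overwrite B (mat d x) (mat d c)) (overwrite Al (left d x) (left d c)) (overwrite Ar (right d x) (right d c)) ⟩
    lookup (overwrite B (mat d x) (mat d c))
           (combine (eval d (overwrite Al (left d x) (left d c)))
                    (eval d (overwrite Ar (right d x) (right d c)))) ∎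
    where open ≡-Reasoning

  sumᵛ-node : ∀ d (g : Vec (Fin k) (nVars k (suc d)) → ℕ) → let m = nVars k d in
    sumᵛ (nVars k (suc d)) g ≡ sumᵛ (k * k) (λ M → sumᵛ m (λ L → sumᵛ m (λ R → g (M ++ (L ++ R)))))
  sumᵛ-node d g = trans (sumᵛ-++ (k * k) g) (sumᵛ-cong (k * k) (λ M → sumᵛ-++ (nVars k d) (λ y → g (M ++ y))))

  -- An event about the left subtree alone leaves the root matrix and the right subtree free.
  sumᵛ-left : ∀ d (g : Vec (Fin k) (nVars k d) → ℕ) →
    sumᵛ (nVars k (suc d)) (g ∘ left d) ≡ k ^ (k * k) * (sumᵛ (nVars k d) g * k ^ nVars k d)
  sumᵛ-left d g = let m = nVars k d in begin
    sumᵛ (nVars k (suc d)) (g ∘ left d)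
      ≡⟨ sumᵛ-node d _ ⟩
    sumᵛ (k * k) (λ M → sumᵛ m (λ L → sumᵛ m (λ R → g (left d (M ++ (L ++ R))))))
      ≡⟨ sumᵛ-cong (k * k) (λ M → sumᵛ-cong m λ L → sumᵛ-cong m λ R → cong g (left-++ d M L R)) ⟩
    sumᵛ (k * k) (λ M → sumᵛ m (λ L → sumᵛ {k} m (λ R → g L)))
      ≡⟨ sumᵛ-const {k} (k * k) _ ⟩
    k ^ (k * k) * sumᵛ m (λ L → sumᵛ {k} m (λ R → g L))
      ≡⟨ cong (k ^ (k * k) *_) (sumᵛ-cong m λ L → trans (sumᵛ-const {k} m (g L)) (*-comm (k ^ m) (g L))) ⟩
    k ^ (k * k) * sumᵛ m (λ L → g L * k ^ m)
      ≡⟨ cong (k ^ (k * k) *_) (sumᵛ-*ʳ m (k ^ m) g) ⟩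
    k ^ (k * k) * (sumᵛ m g * k ^ m) ∎
    where open ≡-Reasoning

  ^-nVars : ∀ d → k ^ nVars k (suc d) ≡ k ^ (k * k) * (k ^ nVars k d * k ^ nVars k d)
  ^-nVars d = trans (^-distribˡ-+-* k (k * k) _) (cong (k ^ (k * k) *_) (^-distribˡ-+-* k (nVars k d) _))

  -- Codes for the sets `A` that contain every leaf and an arbitrary part of each matrix.
  MatrixSubsets : ℕ → Set
  MatrixSubsets zero    = Unit
  MatrixSubsets (suc d) = Subset (k * k) × MatrixSubsets d × MatrixSubsets d

  withLeaves : ∀ d → MatrixSubsets d → Subset (nVars k d)
  withLeaves zero    _            = ⊤
  withLeaves (suc d) (B , tl , tr) = B ++ (withLeaves d tl ++ withLeaves d tr)

  -- This is `(k * k) ^ nodes d` times the probability that every inspected entry is known.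
  weight : ∀ d → MatrixSubsets d → ℕ
  weight zero    _             = 1
  weight (suc d) (B , tl , tr) = ∣ B ∣ * (weight d tl * weight d tr)

  -- All matrix entries inspected by the evaluation lie in the given subsets.
  known : ∀ d → MatrixSubsets d → Vec (Fin k) (nVars k d) → Bool
  known zero    _             x = true
  known (suc d) (B , tl , tr) x =
    known d tl (left d x) ∧ (known d tr (right d x) ∧
      lookup B (combine (eval d (left d x)) (eval d (right d x))))

  -- By induction both children keep their values, hence the same entry of the root matrix is
  -- inspected; as it lies in `B`, it is still read from `x`.
  known-sound : ∀ d t x c → known d t x ≡ true → eval d (overwrite (withLeaves d t) x c) ≡ eval d x
  known-sound zero    t (x ∷ []) (c ∷ []) _ = refl
  known-sound (suc d) (B , tl , tr) x c kx
    with kl , kx′ ← ∧-true {known d tl (left d x)} kx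
    with kr , kB ← ∧-true {known d tr (right d x)} kx′ = begin
    eval (suc d) (overwrite (withLeaves (suc d) (B , tl , tr)) x c)
      ≡⟨ eval-overwrite d B (withLeaves d tl) (withLeaves d tr) x c ⟩
    lookup (overwrite B (mat d x) (mat d c)) _
      ≡⟨ cong (lookup (overwrite B (mat d x) (mat d c))) (cong₂ combine (known-sound d tl (left d x) (left d c) kl) (known-sound d tr (right d x) (right d c) kr)) ⟩
    lookup (overwrite B (mat d x) (mat d c)) ab
      ≡⟨ lookup-overwrite B (mat d x) (mat d c) ab ⟩
    (if lookup B ab then lookup (mat d x) ab else lookup (mat d c) ab)
      ≡⟨ cong (if_then lookup (mat d x) ab else lookup (mat d c) ab) kB ⟩
    lookup (mat d x) ab
      ≡⟨ eval-node d (mat d x) (left d x) (right d x) ⟨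
    eval (suc d) (mat d x ++ (left d x ++ right d x))
      ≡⟨ cong (eval (suc d)) (node-η d x) ⟩
    eval (suc d) x ∎
    where
    open ≡-Reasoning
    ab : Fin (k * k)
    ab = combine (eval d (left d x)) (eval d (right d x))

  knownValue : ∀ d → MatrixSubsets d → Fin k → Vec (Fin k) (nVars k d) → Bool
  knownValue d t v x = known d t x ∧ does (eval d x ≟ v)

  -- Case distinction over the values `a`, `b` of the children. Only the pair of actual values can
  -- contribute, and each summand is a product of factors that involve `L`, `R` or `M` alone.
  knownValue-node : ∀ d B tl tr v M L R →
    ⟦ knownValue (suc d) (B , tl , tr) v (M ++ (L ++ R)) ⟧ ≡
      sum (λ a → sum (λ b → ⟦ knownValue d tl a L ⟧ * (⟦ knownValue d tr b R ⟧ *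
        (⟦ lookup B (combine a b) ⟧ * δ (lookup M (combine a b)) v))))
  knownValue-node d B tl tr v M L R = sym (begin
    sum (λ a → sum (λ b → ⟦ knownValue d tl a L ⟧ * (⟦ knownValue d tr b R ⟧ * F a b)))
      -- The indicator of `knownValue d tr b R` contains the factor `δ eR b`, which collapses the
      -- sum over `b`; the next step collapses the sum over `a` in the same way.
      ≡⟨ sum-cong-≗ (λ a → trans (sum-cong-≗ (λ b →
           trans (cong (λ w → ⟦ knownValue d tl a L ⟧ * (w * F a b)) (⟦⟧-∧ (known d tr R) _))
                 (moveδ ⟦ knownValue d tl a L ⟧ ⟦ known d tr R ⟧ (δ eR b) (F a b))))
           (sum-δ eR (λ b → ⟦ knownValue d tl a L ⟧ * (⟦ known d tr R ⟧ * F a b)))) ⟩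
    sum (λ a → ⟦ knownValue d tl a L ⟧ * (⟦ known d tr R ⟧ * F a eR))
      ≡⟨ trans (sum-cong-≗ (λ a →
           trans (cong (_* (⟦ known d tr R ⟧ * F a eR)) (⟦⟧-∧ (known d tl L) _))
                 (moveδ′ ⟦ known d tl L ⟧ (δ eL a) _)))
           (sum-δ eL (λ a → ⟦ known d tl L ⟧ * (⟦ known d tr R ⟧ * F a eR))) ⟩
    ⟦ known d tl L ⟧ * (⟦ known d tr R ⟧ * (⟦ lookup B (combine eL eR) ⟧ * δ (lookup M (combine eL eR)) v))
      ≡⟨ assoc ⟦ known d tl L ⟧ ⟦ known d tr R ⟧ ⟦ lookup B (combine eL eR) ⟧ _ ⟩
    ⟦ known d tl L ⟧ * (⟦ known d tr R ⟧ * ⟦ lookup B (combine eL eR) ⟧) * δ (lookup M (combine eL eR)) v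
      ≡⟨ cong (_* δ (lookup M (combine eL eR)) v)
           (trans (⟦⟧-∧ (known d tl L) _) (cong (⟦ known d tl L ⟧ *_) (⟦⟧-∧ (known d tr R) _))) ⟨
    ⟦ known d tl L ∧ (known d tr R ∧ lookup B (combine eL eR)) ⟧ * δ (lookup M (combine eL eR)) v
      ≡⟨ cong₂ _*_
           (cong₂ (λ L′ R′ → ⟦ known d tl L′ ∧ (known d tr R′ ∧ lookup B (combine (eval d L′) (eval d R′))) ⟧)
             (left-++ d M L R) (right-++ d M L R))
           (cong (λ w → δ w v) (eval-node d M L R)) ⟨
    ⟦ known (suc d) (B , tl , tr) (M ++ (L ++ R)) ⟧ * δ (eval (suc d) (M ++ (L ++ R))) v
      ≡⟨ ⟦⟧-∧ (known (suc d) (B , tl , tr) (M ++ (L ++ R))) _ ⟨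
    ⟦ knownValue (suc d) (B , tl , tr) v (M ++ (L ++ R)) ⟧ ∎)
    where
    open ≡-Reasoning
    eL eR : Fin k
    eL = eval d L
    eR = eval d R
    F : Fin k → Fin k → ℕ
    F a b = ⟦ lookup B (combine a b) ⟧ * δ (lookup M (combine a b)) v
    moveδ : ∀ p q e f → p * (q * e * f) ≡ e * (p * (q * f))
    moveδ = solve-∀
    moveδ′ : ∀ q e f → q * e * f ≡ e * (q * f)
    moveδ′ = solve-∀
    assoc : ∀ p q r s → p * (q * (r * s)) ≡ p * (q * r) * s
    assoc = solve-∀

  -- Moves the sums over the children's values outside, so that independence applies for each fixed
  -- pair `a`, `b`.
  sumᵛ³-sum² : ∀ m (G : Fin k → Fin k → Vec (Fin k) (k * k) → Vec (Fin k) m → Vec (Fin k) m → ℕ) →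
    sumᵛ (k * k) (λ M → sumᵛ m (λ L → sumᵛ m (λ R → sum (λ a → sum (λ b → G a b M L R)))))
      ≡ sum (λ a → sum (λ b → sumᵛ (k * k) (λ M → sumᵛ m (λ L → sumᵛ m (G a b M L)))))
  sumᵛ³-sum² m G =
    trans (pull (λ a M L R → sum (λ b → G a b M L R))) (sum-cong-≗ (λ a → pull (G a)))
    where
    pull : (H : Fin k → Vec (Fin k) (k * k) → Vec (Fin k) m → Vec (Fin k) m → ℕ) →
      sumᵛ (k * k) (λ M → sumᵛ m (λ L → sumᵛ m (λ R → sum (λ a → H a M L R))))
        ≡ sum (λ a → sumᵛ (k * k) (λ M → sumᵛ m (λ L → sumᵛ m (H a M L))))
    pull H =
      trans (sumᵛ-cong (k * k) (λ M →
        trans (sumᵛ-cong m (λ L → sumᵛ-sum m (λ a → H a M L)))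
              (sumᵛ-sum m (λ a L → sumᵛ m (H a M L)))))
        (sumᵛ-sum (k * k) (λ a M → sumᵛ m (λ L → sumᵛ m (H a M L))))

  -- For a uniformly random input the event that the value is known and equal to v has
  -- probability (1/k) · ∏ ∣B∣ / k², the product being over the internal nodes.
  count-knownValue : ∀ d t v →
    sumᵛ (nVars k d) (⟦_⟧ ∘ knownValue d t v) * (k * (k * k) ^ nodes d) ≡ weight d t * k ^ nVars k d
  count-knownValue zero _ v =
    trans (cong (sumᵛ 1 (⟦_⟧ ∘ knownValue 0 tt v) *_) (*-identityʳ k))
          (trans (cong (_* k) (sumᵛ-cong 1 {⟦_⟧ ∘ knownValue 0 tt v} {λ x → δ (lookup x zero) v} (λ { (x ∷ []) → refl })))
                 (trans (sumᵛ-lookup {1} zero v) (sym (+-identityʳ (k ^ 1)))))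
  count-knownValue (suc d) t@(B , tl , tr) v = begin
    sumᵛ (nVars k (suc d)) (⟦_⟧ ∘ knownValue (suc d) t v) * D
      ≡⟨ cong (_* D) (trans (sumᵛ-node d _) (sumᵛ-cong (k * k) λ M → sumᵛ-cong n′ λ L → sumᵛ-cong n′ λ R →
           knownValue-node d B tl tr v M L R)) ⟩
    sumᵛ (k * k) (λ M → sumᵛ n′ (λ L → sumᵛ n′ (λ R → sum (λ a → sum (λ b →
      ⟦ knownValue d tl a L ⟧ * (⟦ knownValue d tr b R ⟧ * (β a b * δ (lookup M (combine a b)) v))))))) * D
      ≡⟨ cong (_* D) (sumᵛ³-sum² n′ _) ⟩
    sum (λ a → sum (λ b → sumᵛ (k * k) (λ M → sumᵛ n′ (λ L → sumᵛ n′ (λ R →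
      ⟦ knownValue d tl a L ⟧ * (⟦ knownValue d tr b R ⟧ * (β a b * δ (lookup M (combine a b)) v))))))) * D
      ≡⟨ cong (_* D) (sum-cong-≗ λ a → sum-cong-≗ λ b → sumᵛ-product (k * k) n′ n′ (β a b) _ _ _) ⟩
    sum (λ a → sum (λ b → cl a * (cr b * (β a b * ε a b)))) * D
      ≡⟨ trans (*-distribʳ-sum D (λ a → sum (λ b → cl a * (cr b * (β a b * ε a b)))))
                 (sum-cong-≗ λ a → *-distribʳ-sum D (λ b → cl a * (cr b * (β a b * ε a b)))) ⟩
    sum (λ a → sum (λ b → cl a * (cr b * (β a b * ε a b)) * D))
      ≡⟨ sum-cong-≗ (λ a → sum-cong-≗ (term a)) ⟩
    sum (λ a → sum (λ b → C * β a b))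
      ≡⟨ trans (*-distribˡ-sum C (λ a → sum (β a))) (sum-cong-≗ λ a → *-distribˡ-sum C (β a)) ⟨
    C * sum (λ a → sum (β a))
      ≡⟨ cong (C *_) (trans (∣∣≡sum B) (sum-combine k (λ i → ⟦ lookup B i ⟧))) ⟨
    C * ∣ B ∣
      ≡⟨ final (weight d tl) (weight d tr) (k ^ n′) (k ^ (k * k)) ∣ B ∣ ⟩
    ∣ B ∣ * (weight d tl * weight d tr) * (k ^ (k * k) * (k ^ n′ * k ^ n′))
      ≡⟨ cong (weight (suc d) t *_) (^-nVars d) ⟨
    weight (suc d) t * k ^ nVars k (suc d) ∎
    where
    open ≡-Reasoning
    n′ E D C : ℕ
    n′ = nVars k d
    E = (k * k) ^ nodes d
    D = k * (k * k) ^ nodes (suc d)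
    C = (weight d tl * k ^ n′) * (weight d tr * k ^ n′) * k ^ (k * k)
    β ε : Fin k → Fin k → ℕ
    β a b = ⟦ lookup B (combine a b) ⟧
    ε a b = sumᵛ (k * k) (λ M → δ (lookup M (combine a b)) v)
    cl cr : Fin k → ℕ
    cl a = sumᵛ n′ (⟦_⟧ ∘ knownValue d tl a)
    cr b = sumᵛ n′ (⟦_⟧ ∘ knownValue d tr b)

    regroup : ∀ p q r s K E → p * (q * (r * s)) * (K * (K * K * (E * E))) ≡ p * (K * E) * (q * (K * E)) * (s * K) * r
    regroup = solve-∀
    final : ∀ p q x y b → p * x * (q * x) * y * b ≡ b * (p * q) * (y * (x * x))
    final = solve-∀

    -- By induction the scaled counts for the children do not depend on `a` and `b`, and a fixed
    -- matrix entry is uniform. So every pair whose entry is known contributes the same amount `C`.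
    term : ∀ a b → cl a * (cr b * (β a b * ε a b)) * D ≡ C * β a b
    term a b = begin
      cl a * (cr b * (β a b * ε a b)) * D
        ≡⟨ cong (λ w → cl a * (cr b * (β a b * ε a b)) * (k * (k * k * w))) (^-distribˡ-+-* (k * k) (nodes d) (nodes d)) ⟩
      cl a * (cr b * (β a b * ε a b)) * (k * (k * k * (E * E)))
        ≡⟨ regroup (cl a) (cr b) (β a b) (ε a b) k E ⟩
      cl a * (k * E) * (cr b * (k * E)) * (ε a b * k) * β a b
        ≡⟨ cong (_* β a b) (cong₂ _*_ (cong₂ _*_ (count-knownValue d tl a) (count-knownValue d tr b)) (sumᵛ-lookup (combine a b) v)) ⟩
      C * β a b ∎

-- Choosing the set A

subset-of-size : ∀ {ℓ} → ℓ ≤ n → ∃ λ (B : Subset n) → ∣ B ∣ ≡ ℓ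
subset-of-size {n} z≤n = ⊥ , ∣⊥∣≡0 n
subset-of-size (s≤s ℓ≤n) with B , e ← subset-of-size ℓ≤n = inside ∷ B , cong suc e

≤-+-split : ∀ {u} a b → u ≤ a + b → ∃₂ λ v w → v ≤ a × w ≤ b × v + w ≡ u
≤-+-split {u} a b u≤a+b with ≤-total u a
... | inj₁ u≤a = u , 0 , u≤a , z≤n , +-identityʳ u
... | inj₂ a≤u = a , u ∸ a , ≤-refl , m≤n+o⇒m∸n≤o u a u≤a+b , m+[n∸m]≡n a≤u

^-double : ∀ b n → b ^ suc (n + n) ≡ b * (b ^ n * b ^ n)
^-double b n = cong (b *_) (^-distribˡ-+-* b n n)

^-distribʳ-* : ∀ a b n → (a * b) ^ n ≡ a ^ n * b ^ n
^-distribʳ-* a b zero    = refl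
^-distribʳ-* a b (suc n) =
  trans (cong (a * b *_) (^-distribʳ-* a b n)) (interchange a b (a ^ n) (b ^ n))
  where
  interchange : ∀ a b c d → a * b * (c * d) ≡ a * c * (b * d)
  interchange = solve-∀

module _ {k : ℕ} where

  fullMatrices : ∀ d → MatrixSubsets {k} d
  fullMatrices zero    = tt
  fullMatrices (suc d) = ⊤ , fullMatrices d , fullMatrices d

  known-full : ∀ d x → known d (fullMatrices d) x ≡ true
  known-full zero    x = refl
  known-full (suc d) x
    rewrite known-full d (left {k} d x) | known-full d (right {k} d x) =
      lookup-replicate (combine (eval {k} d (left {k} d x)) (eval {k} d (right {k} d x))) true

  weight-full : ∀ d → weight {k} d (fullMatrices d) ≡ (k * k) ^ nodes d
  weight-full zero    = refl
  weight-full (suc d) rewrite weight-full d =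
    trans (cong (_* ((k * k) ^ nodes d * (k * k) ^ nodes d)) (∣⊤∣≡n (k * k))) (sym (^-double (k * k) (nodes d)))

  -- The `u` deletions are spread greedily, at most `q` in each of the `nodes d` matrices, so that
  -- every matrix keeps at least `k * k ∸ q` entries. Leaves are never deleted.
  delete : ∀ d q u → q ≤ k * k → u ≤ nodes d * q →
    ∃ λ t → ∣ withLeaves {k} d t ∣ + u ≡ nVars k d × (k * k ∸ q) ^ nodes d ≤ weight d t
  delete zero    q .0 q≤ z≤n = tt , refl , ≤-refl
  delete (suc d) q u  q≤ u≤
    -- `v` deletions go to the root matrix; the remaining `w` are divided between the subtrees.
    with v , w , v≤q , w≤ , refl ← ≤-+-split q ((nodes d + nodes d) * q) u≤
    with wl , wr , wl≤ , wr≤ , refl ← ≤-+-split (nodes d * q) (nodes d * q)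
           (≤-trans w≤ (≤-reflexive (*-distribʳ-+ q (nodes d) (nodes d))))
    with B  , ∣B∣≡       ← subset-of-size (m∸n≤m (k * k) v)
       | tl , size-l , weight-l ← delete d q wl q≤ wl≤
       | tr , size-r , weight-r ← delete d q wr q≤ wr≤
    = (B , tl , tr) , size , weight≤
    where
    sl sr : ℕ
    sl = ∣ withLeaves {k} d tl ∣
    sr = ∣ withLeaves {k} d tr ∣
    regroup : ∀ b l r x y z → b + (l + r) + (x + (y + z)) ≡ (b + x) + ((l + y) + (r + z))
    regroup = solve-∀
    size : ∣ withLeaves {k} (suc d) (B , tl , tr) ∣ + (v + (wl + wr)) ≡ nVars k (suc d)
    size = begin
      ∣ withLeaves {k} (suc d) (B , tl , tr) ∣ + (v + (wl + wr))
        ≡⟨ cong (_+ (v + (wl + wr))) (trans (∣++∣ B _) (cong₂ _+_ ∣B∣≡ (∣++∣ (withLeaves d tl) _))) ⟩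
      (k * k ∸ v) + (sl + sr) + (v + (wl + wr))
        ≡⟨ regroup (k * k ∸ v) sl sr v wl wr ⟩
      (k * k ∸ v + v) + ((sl + wl) + (sr + wr))
        ≡⟨ cong₂ _+_ (m∸n+n≡m (≤-trans v≤q q≤)) (cong₂ _+_ size-l size-r) ⟩
      nVars k (suc d) ∎
      where open ≡-Reasoning
    weight≤ : (k * k ∸ q) ^ nodes (suc d) ≤ weight {k} (suc d) (B , tl , tr)
    weight≤ = begin
      (k * k ∸ q) ^ nodes (suc d)
        ≡⟨ ^-double (k * k ∸ q) (nodes d) ⟩
      (k * k ∸ q) * ((k * k ∸ q) ^ nodes d * (k * k ∸ q) ^ nodes d)
        ≤⟨ *-mono-≤ (≤-trans (∸-monoʳ-≤ (k * k) v≤q) (≤-reflexive (sym ∣B∣≡))) (*-mono-≤ weight-l weight-r) ⟩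
      weight {k} (suc d) (B , tl , tr) ∎
      where open ≤-Reasoning

-- Equal rows for every size

module _ {κ-1 : ℕ} where

  private
    κ = suc κ-1

    k²-power≢0 : ∀ d → NonZero ((κ * κ) ^ nodes d)
    k²-power≢0 d = m^n≢0 (κ * κ) (nodes d)

  -- The case of `count-knownValue` in which all entries are known; the factor `(κ * κ) ^ nodes d`
  -- cancels.
  eval-uniform : ∀ d v → sumᵛ (nVars κ d) (λ x → δ (eval d x) v) * κ ≡ κ ^ nVars κ d
  eval-uniform d v = *-cancelʳ-≡ _ _ K {{k²-power≢0 d}} (begin
    sumᵛ N (λ x → δ (eval d x) v) * κ * K
      ≡⟨ *-assoc (sumᵛ N (λ x → δ (eval d x) v)) κ K ⟩
    sumᵛ N (λ x → δ (eval d x) v) * (κ * K)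
      ≡⟨ cong (_* (κ * K)) (sumᵛ-cong N λ x → cong (λ b → ⟦ b ∧ does (eval d x ≟ v) ⟧) (known-full d x)) ⟨
    sumᵛ N (⟦_⟧ ∘ knownValue d (fullMatrices d) v) * (κ * K)
      ≡⟨ count-knownValue d (fullMatrices d) v ⟩
    weight d (fullMatrices d) * κ ^ N
      ≡⟨ cong (_* κ ^ N) (weight-full d) ⟩
    K * κ ^ N
      ≡⟨ *-comm K (κ ^ N) ⟩
    κ ^ N * K ∎)
    where
    open ≡-Reasoning
    N = nVars κ d
    K = (κ * κ) ^ nodes d

  -- In the inverse density, `κ` pays for prescribing a value, and each internal node pays a factor
  -- 2 for losing up to half of its matrix.
  TreeRows : ℕ → ℕ → Set
  TreeRows d ℓ = EqualRows (evalTree κ d) ℓ (κ * 2 ^ nodes d)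

  -- All inputs whose value is known to be 0 induce the constant row 0. Each matrix keeps at least
  -- half of its entries, so `weight d t * 2 ^ nodes d` is at least `(κ * κ) ^ nodes d`.
  rows-delete : ∀ d ℓ u → ℓ + u ≡ nVars κ d → u ≤ nodes d * ⌊ κ * κ /2⌋ → TreeRows d ℓ
  rows-delete d ℓ u ℓ+u≡N u≤
    with t , size , weight≤ ← delete {κ} d ⌊ κ * κ /2⌋ u (⌊n/2⌋≤n (κ * κ)) u≤ = record
    { A       = withLeaves d t
    ; size    = +-cancelʳ-≡ u _ _ (trans size (sym ℓ+u≡N))
    ; Q       = knownValue d t zero
    ; row     = λ _ → zero
    ; row-eq  = λ x c q → let kn , ev = ∧-true {known d t x} q in trans (known-sound d t x c kn) (does⇒≡ ev)
    ; density = *-cancelʳ-≤ _ _ K {{k²-power≢0 d}} (begin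
        κ ^ N * K                    ≤⟨ *-monoʳ-≤ (κ ^ N) K≤ ⟩
        κ ^ N * (weight d t * 2 ^ ν) ≡⟨ swap (κ ^ N) (weight d t) (2 ^ ν) ⟩
        weight d t * κ ^ N * 2 ^ ν   ≡⟨ cong (_* 2 ^ ν) (count-knownValue d t zero) ⟨
        S * (κ * K) * 2 ^ ν          ≡⟨ swap′ S κ K (2 ^ ν) ⟩
        S * (κ * 2 ^ ν) * K          ∎)
    }
    where
    open ≤-Reasoning
    N ν K S : ℕ
    N = nVars κ d
    ν = nodes d
    K = (κ * κ) ^ ν
    S = sumᵛ N (⟦_⟧ ∘ knownValue d t zero)
    swap : ∀ a b c → a * (b * c) ≡ b * a * c
    swap = solve-∀
    swap′ : ∀ a b c e → a * (b * c) * e ≡ a * (b * e) * c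
    swap′ = solve-∀
    half : ∀ s → s ≤ (s ∸ ⌊ s /2⌋) * 2
    half s = begin
      s                             ≡⟨ ⌊n/2⌋+⌈n/2⌉≡n s ⟨
      ⌊ s /2⌋ + ⌈ s /2⌉             ≤⟨ +-monoˡ-≤ ⌈ s /2⌉ (⌊n/2⌋≤⌈n/2⌉ s) ⟩
      ⌈ s /2⌉ + ⌈ s /2⌉             ≡⟨ cong (λ c → c + c) (trans (cong (_∸ ⌊ s /2⌋) (sym (⌊n/2⌋+⌈n/2⌉≡n s))) (m+n∸m≡n ⌊ s /2⌋ _)) ⟨
      (s ∸ ⌊ s /2⌋) + (s ∸ ⌊ s /2⌋) ≡⟨ trans (*-comm (s ∸ ⌊ s /2⌋) 2) (cong (λ w → (s ∸ ⌊ s /2⌋) + w) (+-identityʳ (s ∸ ⌊ s /2⌋))) ⟨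
      (s ∸ ⌊ s /2⌋) * 2             ∎
    K≤ : K ≤ weight d t * 2 ^ ν
    K≤ = begin
      (κ * κ) ^ ν                                ≤⟨ ^-monoˡ-≤ ν (half (κ * κ)) ⟩
      ((κ * κ ∸ ⌊ κ * κ /2⌋) * 2) ^ ν            ≡⟨ ^-distribʳ-* (κ * κ ∸ ⌊ κ * κ /2⌋) 2 ν ⟩
      (κ * κ ∸ ⌊ κ * κ /2⌋) ^ ν * 2 ^ ν          ≤⟨ *-monoˡ-≤ (2 ^ ν) weight≤ ⟩
      weight d t * 2 ^ ν                         ∎

  -- The variables outside the left subtree are free, so the density carries over. The factor `c` is
  -- `2 ^ nodes d` in one application and 1 in the other.
  density-left : ∀ d c (g : Vec (Fin κ) (nVars κ d) → ℕ) →
    κ ^ nVars κ d ≤ sumᵛ (nVars κ d) g * (κ * c) → c ≤ 2 ^ nodes (suc d) →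
    κ ^ nVars κ (suc d) ≤ sumᵛ (nVars κ (suc d)) (g ∘ left {κ} d) * (κ * 2 ^ nodes (suc d))
  density-left d c g dense c≤ = begin
    κ ^ nVars κ (suc d)                     ≡⟨ ^-nVars {κ} d ⟩
    κ ^ (κ * κ) * (κ ^ m′ * κ ^ m′)         ≤⟨ *-monoʳ-≤ (κ ^ (κ * κ)) (*-monoˡ-≤ (κ ^ m′) dense) ⟩
    κ ^ (κ * κ) * (S * (κ * c) * κ ^ m′)    ≡⟨ swap (κ ^ (κ * κ)) S (κ * c) (κ ^ m′) ⟩
    κ ^ (κ * κ) * (S * κ ^ m′) * (κ * c)    ≡⟨ cong (_* (κ * c)) (sumᵛ-left d g) ⟨
    sumᵛ (nVars κ (suc d)) (g ∘ left {κ} d) * (κ * c)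
      ≤⟨ *-monoʳ-≤ (sumᵛ (nVars κ (suc d)) (g ∘ left {κ} d)) (*-monoʳ-≤ κ c≤) ⟩
    sumᵛ (nVars κ (suc d)) (g ∘ left {κ} d) * (κ * 2 ^ nodes (suc d)) ∎
    where
    open ≤-Reasoning
    m′ S : ℕ
    m′ = nVars κ d
    S = sumᵛ m′ g
    swap : ∀ a b c e → a * (b * c * e) ≡ a * (b * e) * c
    swap = solve-∀

  -- On the chosen event the left value depends on `c` only, and the root matrix and the right
  -- subtree are read from `c` entirely.
  rows-left : ∀ d ℓ → TreeRows d ℓ → TreeRows (suc d) ℓ
  rows-left d ℓ e = record
    { A       = ⊥ {κ * κ} ++ (A ++ ⊥ {nVars κ d})
    ; size    = trans (∣++∣ (⊥ {κ * κ}) _) (cong₂ _+_ (∣⊥∣≡0 (κ * κ))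
                  (trans (∣++∣ A _) (trans (cong₂ _+_ size (∣⊥∣≡0 (nVars κ d))) (+-identityʳ ℓ))))
    ; Q       = Q ∘ left {κ} d
    ; row     = λ c → lookup (mat {κ} d c) (combine (row (left {κ} d c)) (eval d (right {κ} d c)))
    ; row-eq  = λ x c q → trans (eval-overwrite d (⊥ {κ * κ}) A (⊥ {nVars κ d}) x c)
                  (cong₂ lookup (overwrite-⊥ (mat {κ} d x) (mat {κ} d c))
                    (cong₂ combine (row-eq (left {κ} d x) (left {κ} d c) q)
                      (cong (eval d) (overwrite-⊥ (right {κ} d x) (right {κ} d c)))))
    ; density = density-left d (2 ^ nodes d) (⟦_⟧ ∘ Q) density
                  (^-monoʳ-≤ 2 (m≤n⇒m≤1+n (m≤m+n (nodes d) (nodes d))))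
    }
    where open EqualRows e

  -- If the left child has value 0, only row 0 of the root matrix is inspected. `A` avoids this row
  -- and the right subtree, so the result depends on `c` only. The event has probability `1 / κ`
  -- because the left value is uniform.
  rows-matrix : ∀ d j → j ≤ κ-1 * κ → TreeRows (suc d) (nVars κ d + j)
  rows-matrix d j j≤ with B , ∣B∣≡j ← subset-of-size j≤ = record
    -- `κ * κ` unfolds to `κ + κ-1 * κ`, whose first block is row 0, the positions `combine zero b`.
    { A       = (⊥ {κ} ++ B) ++ (⊤ {nVars κ d} ++ ⊥ {nVars κ d})
    ; size    = trans (∣++∣ (⊥ {κ} ++ B) _) (trans (cong₂ _+_
                  (trans (∣++∣ (⊥ {κ}) B) (cong₂ _+_ (∣⊥∣≡0 κ) ∣B∣≡j))
                  (trans (∣++∣ (⊤ {nVars κ d}) _) (trans (cong₂ _+_ (∣⊤∣≡n (nVars κ d)) (∣⊥∣≡0 (nVars κ d))) (+-identityʳ _))))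
                  (+-comm j _))
    ; Q       = λ x → does (eval d (left {κ} d x) ≟ zero)
    ; row     = λ c → lookup (mat {κ} d c) (combine {κ} zero (eval d (right {κ} d c)))
    ; row-eq  = λ x c q → trans (eval-overwrite d (⊥ {κ} ++ B) ⊤ ⊥ x c)
                  (trans (cong (lookup (overwrite (⊥ {κ} ++ B) (mat {κ} d x) (mat {κ} d c)))
                    (cong₂ combine
                      (trans (cong (eval d) (overwrite-⊤ (left {κ} d x) (left {κ} d c))) (does⇒≡ q))
                      (cong (eval d) (overwrite-⊥ (right {κ} d x) (right {κ} d c)))))
                  (row-0 B (mat {κ} d x) (mat {κ} d c) (eval d (right {κ} d c))))
    ; density = density-left d 1 (λ L → δ (eval d L) zero)
                  (≤-reflexive (sym (trans (cong (sumᵛ (nVars κ d) (λ L → δ (eval d L) zero) *_) (*-identityʳ κ)) (eval-uniform d zero))))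
                  (m^n>0 2 (nodes (suc d)))
    }
    where
    row-0 : ∀ (B : Subset (κ-1 * κ)) (M M′ : Vec (Fin κ) (κ * κ)) b →
      lookup (overwrite (⊥ {κ} ++ B) M M′) (combine {κ} zero b) ≡ lookup M′ (combine {κ} zero b)
    row-0 B M M′ b = trans (lookup-overwrite (⊥ {κ} ++ B) M M′ (combine {κ} zero b))
      (cong (if_then lookup M (combine {κ} zero b) else lookup M′ (combine {κ} zero b))
        (trans (lookup-++ˡ (⊥ {κ}) B b) (lookup-replicate b false)))

  -- `nVars κ d = ν * s + ν + 1` and `s ≤ 2 * q + 1` reduce the claim to `κ + 2 * ν ≤ q`. Since
  -- `4 + 4 * ν ≤ κ`, the left side is at most `2 * κ`, and `2 * κ ≤ q` because `4 ≤ κ`.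
  few-deletions : ∀ d u → 2 ^ suc (suc d) ≤ κ → suc u ≤ κ + nVars κ d → u ≤ nodes (suc d) * ⌊ κ * κ /2⌋
  few-deletions d u 2^d+2≤k u<k+N = begin
    u                                     ≤⟨ ≤-pred u<k+N′ ⟩
    κ + ν * s + ν                         ≤⟨ +-monoˡ-≤ ν (+-monoʳ-≤ κ (*-monoʳ-≤ ν s≤1+2q)) ⟩
    κ + ν * suc (q + q) + ν               ≡⟨ regroup κ ν q ⟩
    κ + (ν + ν) + (ν + ν) * q             ≤⟨ +-monoˡ-≤ ((ν + ν) * q) k+2n≤q ⟩
    q + (ν + ν) * q                       ∎
    where
    open ≤-Reasoning
    ν s q : ℕ
    ν = nodes d
    s = κ * κ
    q = ⌊ s /2⌋
    regroup : ∀ κ ν q → κ + ν * suc (q + q) + ν ≡ κ + (ν + ν) + (ν + ν) * q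
    regroup = solve-∀
    u<k+N′ : suc u ≤ suc (κ + ν * s + ν)
    u<k+N′ = begin
      suc u                 ≤⟨ u<k+N ⟩
      κ + nVars κ d         ≡⟨ cong (λ w → κ + w) (nVars≡ κ d) ⟩
      κ + (ν * s + suc ν)   ≡⟨ trans (sym (+-assoc κ (ν * s) (suc ν))) (+-suc (κ + ν * s) ν) ⟩
      suc (κ + ν * s + ν)   ∎
    s≤1+2q : s ≤ suc (q + q)
    s≤1+2q = begin
      s             ≡⟨ ⌊n/2⌋+⌈n/2⌉≡n s ⟨
      q + ⌈ s /2⌉   ≤⟨ +-monoʳ-≤ q (≤-trans (⌊n/2⌋-mono (n≤1+n (suc s))) ≤-refl) ⟩
      q + suc q     ≡⟨ +-suc q q ⟩
      suc (q + q)   ∎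
    4+4n≤k : 4 + 4 * ν ≤ κ
    4+4n≤k = begin
      4 + 4 * ν         ≡⟨ 4+4n ν ⟩
      2 * (2 * suc ν)   ≡⟨ cong (λ p → 2 * (2 * p)) (suc-nodes d) ⟩
      2 ^ suc (suc d)   ≤⟨ 2^d+2≤k ⟩
      κ                 ∎
      where
      4+4n : ∀ ν → 4 + 4 * ν ≡ 2 * (2 * suc ν)
      4+4n = solve-∀
    k+2n≤q : κ + (ν + ν) ≤ q
    k+2n≤q = begin
      κ + (ν + ν)           ≤⟨ +-monoʳ-≤ κ (≤-trans (m≤m+n (ν + ν) (4 + (ν + ν))) (≤-trans (≤-reflexive (2n ν)) 4+4n≤k)) ⟩
      κ + κ                 ≡⟨ n≡⌊n+n/2⌋ (κ + κ) ⟩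
      ⌊ κ + κ + (κ + κ) /2⌋ ≡⟨ cong ⌊_/2⌋ (4k κ) ⟩
      ⌊ 4 * κ /2⌋           ≤⟨ ⌊n/2⌋-mono (*-monoˡ-≤ κ (≤-trans (m≤m+n 4 (4 * ν)) 4+4n≤k)) ⟩
      q                     ∎
      where
      2n : ∀ ν → ν + ν + (4 + (ν + ν)) ≡ 4 + 4 * ν
      2n = solve-∀
      4k : ∀ κ → κ + κ + (κ + κ) ≡ 4 * κ
      4k = solve-∀

  rows-exist : ∀ d ℓ → 2 ^ suc d ≤ κ → 1 ≤ ℓ → ℓ ≤ nVars κ d → TreeRows d ℓ
  -- A tree of height 1 has a single variable, so `ℓ = 1` and nothing is deleted.
  rows-exist zero    ℓ 2^≤k 1≤ℓ ℓ≤N =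
    rows-delete zero ℓ 0 (trans (+-identityʳ ℓ) (≤-antisym ℓ≤N 1≤ℓ)) z≤n
  rows-exist (suc d) ℓ 2^≤k 1≤ℓ ℓ≤N with ℓ ≤? nVars κ d
  ... | yes ℓ≤m = rows-left d ℓ (rows-exist d ℓ (≤-trans (^-monoʳ-≤ 2 (n≤1+n (suc d))) 2^≤k) 1≤ℓ ℓ≤m)
  ... | no  ℓ≰m with j , refl ← m≤n⇒∃[o]m+o≡n (<⇒≤ (≰⇒> ℓ≰m)) with j ≤? κ-1 * κ
  ...   | yes j≤ = rows-matrix d j j≤
  ...   | no  j≰ with u , ℓ+u≡N ← m≤n⇒∃[o]m+o≡n ℓ≤N =
    -- As `j` exceeds `κ * κ - κ`, fewer than `κ + nVars κ d` variables are left out.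
    rows-delete (suc d) (nVars κ d + j) u ℓ+u≡N (few-deletions d u 2^≤k
      (+-cancelˡ-≤ (nVars κ d + κ-1 * κ) _ _ (begin
        nVars κ d + κ-1 * κ + suc u               ≡⟨ trans (+-suc _ u) (cong (_+ u) (sym (+-suc (nVars κ d) (κ-1 * κ)))) ⟩
        nVars κ d + suc (κ-1 * κ) + u             ≤⟨ +-monoˡ-≤ u (+-monoʳ-≤ (nVars κ d) (≰⇒> j≰)) ⟩
        nVars κ d + j + u                         ≡⟨ ℓ+u≡N ⟩
        κ * κ + (nVars κ d + nVars κ d)           ≡⟨ regroup (κ-1 * κ) κ (nVars κ d) ⟩
        nVars κ d + κ-1 * κ + (κ + nVars κ d)     ∎)))
    where
    open ≤-Reasoning
    regroup : ∀ r κ m → κ + r + (m + m) ≡ m + r + (κ + m)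
    regroup = solve-∀

-- Rational bounds

-- The head of the list is the starting value of the fold, so it stays fixed while the induction
-- runs over the tail.
minℚ-≤ : ∀ {q qs} → q ∈ qs → minℚ qs ≤ℚ q
minℚ-≤ {q} {p ∷ qs} = go qs
  where
  go : ∀ qs → q ∈ p ∷ qs → foldr _⊓ℚ_ p qs ≤ℚ q
  go []       (here refl)         = ℚ.≤-refl
  go (r ∷ qs) (here refl)         = ℚ.≤-trans (ℚ.p⊓q≤q r _) (go qs (here refl))
  go (r ∷ qs) (there (here refl)) = ℚ.p⊓q≤p r _
  go (r ∷ qs) (there (there i))   = ℚ.≤-trans (ℚ.p⊓q≤q r _) (go qs (there i))

-- The member `q` excludes the empty list, where `minℚ` takes the default value 0.
minℚ-glb : ∀ {b q qs} → q ∈ qs → (∀ p → p ∈ qs → b ≤ℚ p) → b ≤ℚ minℚ qs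
minℚ-glb {b} {_} {p ∷ qs} _ = go qs
  where
  go : ∀ qs → (∀ q → q ∈ p ∷ qs → b ≤ℚ q) → b ≤ℚ foldr _⊓ℚ_ p qs
  go []       b≤ = b≤ p (here refl)
  go (r ∷ qs) b≤ = ℚ.⊓-glb (b≤ r (there (here refl)))
    (go qs λ { q (here e) → b≤ q (here e) ; q (there i) → b≤ q (there (there i)) })

≤-maxℚ : ∀ {q qs} → q ∈ qs → q ≤ℚ maxℚ qs
≤-maxℚ {q} {p ∷ qs} = go qs
  where
  go : ∀ qs → q ∈ p ∷ qs → q ≤ℚ foldr _⊔ℚ_ p qs
  go []       (here refl)         = ℚ.≤-refl
  go (r ∷ qs) (here refl)         = ℚ.≤-trans (go qs (here refl)) (ℚ.p≤q⊔p r _)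
  go (r ∷ qs) (there (here refl)) = ℚ.p≤p⊔q r _
  go (r ∷ qs) (there (there i))   = ℚ.≤-trans (go qs (there i)) (ℚ.p≤q⊔p r _)

maxℚ-lub : ∀ {b} → 0ℚ ≤ℚ b → ∀ qs → (∀ p → p ∈ qs → p ≤ℚ b) → maxℚ qs ≤ℚ b
maxℚ-lub 0≤b [] _ = 0≤b
maxℚ-lub {b} _ (p ∷ qs) = go qs
  where
  go : ∀ qs → (∀ q → q ∈ p ∷ qs → q ≤ℚ b) → foldr _⊔ℚ_ p qs ≤ℚ b
  go []       ≤b = ≤b p (here refl)
  go (r ∷ qs) ≤b = ℚ.⊔-lub (≤b r (there (here refl)))
    (go qs λ { q (here e) → ≤b q (here e) ; q (there i) → ≤b q (there (there i)) })

∈-subsetsOfSize⁺ : (A : Subset n) → A ∈ subsetsOfSize n ∣ A ∣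
∈-subsetsOfSize⁺ {n} A = ∈-filter⁺ _ (∈-vecsOver Bool-complete A)
  (≡⇒≡ᵇ ∣ A ∣ ∣ A ∣ refl)
  where
  Bool-complete : ∀ b → b ∈ outside ∷ inside ∷ []
  Bool-complete false = here refl
  Bool-complete true  = there (here refl)

∈-subsetsOfSize⁻ : ∀ {ℓ} {A : Subset n} → A ∈ subsetsOfSize n ℓ → ∣ A ∣ ≡ ℓ
∈-subsetsOfSize⁻ {n} {ℓ} {A} i = ≡ᵇ⇒≡ ∣ A ∣ ℓ (proj₂ (∈-filter⁻ _ {xs = allSubsets n} i))

module _ {k N : ℕ} (f : (Fin N → Fin k) → Fin k) where

  levelMin : ℕ → ℚ
  levelMin ℓ = minℚ (List.map (ratio f) (subsetsOfSize N ℓ))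

  Ŝ-upper : ∀ {b} → 0ℚ ≤ℚ b →
    (∀ ℓ → 1 ≤ ℓ → ℓ ≤ N → ∃ λ A → ∣ A ∣ ≡ ℓ × ratio f A ≤ℚ b) → Ŝ f ≤ℚ b
  Ŝ-upper {b} 0≤b good = maxℚ-lub 0≤b (List.map levelMin (List.map suc (upTo N))) level
    where
    levelMin≤b : ∀ {ℓ} → (∃ λ A → ∣ A ∣ ≡ ℓ × ratio f A ≤ℚ b) → levelMin ℓ ≤ℚ b
    levelMin≤b (A , refl , r≤b) = ℚ.≤-trans (minℚ-≤ (∈-map⁺ (ratio f) (∈-subsetsOfSize⁺ A))) r≤b

    level : ∀ q → q ∈ List.map levelMin (List.map suc (upTo N)) → q ≤ℚ b
    level q q∈ =
      let ℓ , ℓ∈ , q≡ = ∈-map⁻ levelMin q∈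
          i , i∈ , ℓ≡ = ∈-map⁻ suc ℓ∈
      in subst (_≤ℚ b) (sym (trans q≡ (cong levelMin ℓ≡))) (levelMin≤b (good (suc i) (s≤s z≤n) (∈-upTo⁻ i∈)))

  -- The maximum is at least its term for size `N`; `⊤` shows that the minimum in this term ranges
  -- over a nonempty list.
  Ŝ-lower : ∀ {b} → 1 ≤ N → (∀ A → ∣ A ∣ ≡ N → b ≤ℚ ratio f A) → b ≤ℚ Ŝ f
  Ŝ-lower {b} 1≤N b≤ = ℚ.≤-trans
    (minℚ-glb (∈-map⁺ (ratio f) (subst (λ ℓ → ⊤ ∈ subsetsOfSize N ℓ) (∣⊤∣≡n N) (∈-subsetsOfSize⁺ ⊤)))
      (λ q q∈ → let A , A∈ , q≡ = ∈-map⁻ (ratio f) q∈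
                in subst (b ≤ℚ_) (sym q≡) (b≤ A (∈-subsetsOfSize⁻ A∈))))
    (≤-maxℚ (∈-map⁺ levelMin (N∈ 1≤N)))
    where
    N∈ : ∀ {N} → 1 ≤ N → N ∈ List.map suc (upTo N)
    N∈ {suc N} _ = ∈-map⁺ suc (∈-upTo⁺ (n<1+n N))

-- `_/_` reduces fractions, so inequalities are checked on unnormalised ones and transported.
fromℚᵘ-mono-≤ : ∀ {p q} → p ℚᵘ.≤ q → fromℚᵘ p ≤ℚ fromℚᵘ q
fromℚᵘ-mono-≤ {p} {q} p≤q = ℚ.toℚᵘ-cancel-≤
  (ℚᵘ.≤-respˡ-≃ (ℚᵘ.≃-sym (ℚ.toℚᵘ-fromℚᵘ p)) (ℚᵘ.≤-respʳ-≃ (ℚᵘ.≃-sym (ℚ.toℚᵘ-fromℚᵘ q)) p≤q))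

/-mono-≤ : ∀ a b c d .{{_ : NonZero b}} .{{_ : NonZero d}} → a * d ≤ c * b → (+ a) / b ≤ℚ (+ c) / d
/-mono-≤ a (suc b) c (suc d) ad≤cb = fromℚᵘ-mono-≤ {ℚᵘ.mkℚᵘ (+ a) b} {ℚᵘ.mkℚᵘ (+ c) d}
  (ℚᵘ.*≤* (subst₂ ℤ._≤_ (pos-* a (suc d)) (pos-* c (suc b)) (ℤ.+≤+ ad≤cb)))

/-*-/1 : ∀ a b c .{{_ : NonZero b}} → (+ a) / b *ℚ ((+ c) / 1) ≡ (+ (a * c)) / b
/-*-/1 a (suc b) c = ℚ.toℚᵘ-injective (begin-equality
  toℚᵘ ((+ a) / suc b *ℚ ((+ c) / 1))            ≃⟨ ℚ.toℚᵘ-homo-* ((+ a) / suc b) ((+ c) / 1) ⟩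
  toℚᵘ ((+ a) / suc b) ℚᵘ.* toℚᵘ ((+ c) / 1)   ≃⟨ ℚᵘ.*-cong (ℚ.toℚᵘ-fromℚᵘ (ℚᵘ.mkℚᵘ (+ a) b)) (ℚ.toℚᵘ-fromℚᵘ (ℚᵘ.mkℚᵘ (+ c) 0)) ⟩
  ℚᵘ.mkℚᵘ (+ a) b ℚᵘ.* ℚᵘ.mkℚᵘ (+ c) 0         ≃⟨ ℚᵘ.*≡* (cong₂ ℤ._*_ (sym (pos-* a c)) (cong (λ m → + suc m) (sym (*-identityʳ b)))) ⟩
  ℚᵘ.mkℚᵘ (+ (a * c)) b                        ≃⟨ ℚ.toℚᵘ-fromℚᵘ (ℚᵘ.mkℚᵘ (+ (a * c)) b) ⟨
  toℚᵘ ((+ (a * c)) / suc b)                   ∎)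
  where open ℚᵘ.≤-Reasoning

n≤suc-pred : ∀ n → n ≤ suc (pred n)
n≤suc-pred zero    = z≤n
n≤suc-pred (suc n) = ≤-refl

upperBound : ℕ → ℕ → ℚ
upperBound k d = ((+ (2 ^ (2 ^ d + 1))) / 3) *ℚ ((+ k) / 1)

-- Bounds for tree evaluation

module _ {κ-1 : ℕ} where

  private
    κ = suc κ-1

  1≤nVars : ∀ d → 1 ≤ nVars κ d
  1≤nVars d = subst (1 ≤_) (sym (nVars≡ κ d))
    (≤-trans (s≤s z≤n) (m≤n+m (suc (nodes d)) (nodes d * (κ * κ))))

  -- By uniformity each value is taken by `κ ^ (N - 1)` inputs, where `N` is the number of
  -- variables. At size `N` this bounds `mult`, and the ratio is at least `κ`.
  Ŝ-TEP-lower : ∀ d → (+ κ) / 1 ≤ℚ Ŝ (evalTree κ d)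
  Ŝ-TEP-lower d = Ŝ-lower (evalTree κ d) (1≤nVars d) (λ A ∣A∣≡N →
    /-mono-≤ κ 1 (κ ^ ∣ A ∣) (suc (pred (mult (evalTree κ d) A))) (≤-trans (*κ≤ A ∣A∣≡N) (≤-reflexive (sym (*-identityʳ _)))))
    where
    -- `suc (pred 0)` is 1, so the zero case rests on `1 ≤ c`.
    suc-pred≤ : ∀ {c} n → n ≤ c → 1 ≤ c → suc (pred n) ≤ c
    suc-pred≤ zero    _   1≤c = 1≤c
    suc-pred≤ (suc n) n≤c _   = n≤c

    *κ≤ : ∀ A → ∣ A ∣ ≡ nVars κ d → κ * suc (pred (mult (evalTree κ d) A)) ≤ κ ^ ∣ A ∣
    *κ≤ A ∣A∣≡N with c , 1+c≡N ← m≤n⇒∃[o]m+o≡n (1≤nVars d) = begin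
      κ * suc (pred (mult (evalTree κ d) A)) ≤⟨ *-monoʳ-≤ κ (suc-pred≤ _ (mult-upper-bound {f = evalTree κ d} A ∣A∣≡N uniform) (m^n>0 κ c)) ⟩
      κ * κ ^ c                              ≡⟨ cong (κ ^_) (trans 1+c≡N (sym ∣A∣≡N)) ⟩
      κ ^ ∣ A ∣                              ∎
      where
      open ≤-Reasoning
      uniform : ∀ v → sumᵛ (nVars κ d) (λ x → δ v (eval d x)) ≤ κ ^ c
      uniform v = *-cancelʳ-≤ _ _ κ (≤-reflexive (trans
        (trans (cong (_* κ) (sumᵛ-cong (nVars κ d) (λ x → δ-comm v (eval d x)))) (eval-uniform d v))
        (trans (cong (κ ^_) (sym 1+c≡N)) (*-comm κ (κ ^ c)))))

  -- The constructed sets have ratio at most `κ * 2 ^ (2 ^ d - 1)`, which is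
  -- `κ * 2 ^ (2 ^ d + 1) / 4`; replacing 4 by 3 gives the stated bound.
  Ŝ-TEP-upper : ∀ d → 2 ^ suc d ≤ κ → Ŝ (evalTree κ d) ≤ℚ upperBound κ d
  Ŝ-TEP-upper d 2^≤κ = subst (Ŝ (evalTree κ d) ≤ℚ_) (sym (/-*-/1 (2 ^ (2 ^ d + 1)) 3 κ))
    (Ŝ-upper (evalTree κ d) (/-mono-≤ 0 1 (2 ^ (2 ^ d + 1) * κ) 3 z≤n) λ ℓ 1≤ℓ ℓ≤N →
      let e = rows-exist d ℓ 2^≤κ 1≤ℓ ℓ≤N
          A = EqualRows.A e
          μ = mult (evalTree κ d) A
      in A , EqualRows.size e , /-mono-≤ (κ ^ ∣ A ∣) (suc (pred μ)) (2 ^ (2 ^ d + 1) * κ) 3 (begin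
        κ ^ ∣ A ∣ * 3                                ≤⟨ *-mono-≤ (mult-lower-bound e) (n≤1+n 3) ⟩
        μ * (κ * 2 ^ nodes d) * 4                    ≡⟨ regroup μ κ (2 ^ nodes d) ⟩
        2 * (2 * 2 ^ nodes d) * κ * μ                ≡⟨ cong (λ p → p * κ * μ) (cong (2 ^_) (trans (cong suc (suc-nodes d)) (+-comm 1 (2 ^ d)))) ⟩
        2 ^ (2 ^ d + 1) * κ * μ                      ≤⟨ *-monoʳ-≤ (2 ^ (2 ^ d + 1) * κ) (n≤suc-pred μ) ⟩
        2 ^ (2 ^ d + 1) * κ * suc (pred μ)           ∎))
    where
    open ≤-Reasoning
    regroup : ∀ m k p → m * (k * p) * 4 ≡ 2 * (2 * p) * k * m
    regroup = solve-∀

-- Since `2 ^ d + 1 ≤ 2 ^ suc d`, the power of two in the bound is at most `k`.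
bound-loglog : ∀ k d → k ≡ 2 ^ (2 ^ suc d) → upperBound k d ≤ℚ (+ (k * k)) / 3
bound-loglog k d k≡ = subst (_≤ℚ (+ (k * k)) / 3) (sym (/-*-/1 (2 ^ (2 ^ d + 1)) 3 k))
  (/-mono-≤ (2 ^ (2 ^ d + 1) * k) 3 (k * k) 3 (*-monoˡ-≤ 3 (*-monoˡ-≤ k (begin
    2 ^ (2 ^ d + 1)         ≤⟨ ^-monoʳ-≤ 2 (+-monoʳ-≤ (2 ^ d) (≤-trans (m^n>0 2 d) (m≤m+n (2 ^ d) 0))) ⟩
    2 ^ (2 ^ suc d)         ≡⟨ k≡ ⟨
    k                       ∎))))
  where open ≤-Reasoning

n<2^n : ∀ n → n < 2 ^ n
n<2^n zero    = s≤s z≤n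
n<2^n (suc n) = begin
  suc (suc n)         ≤⟨ +-mono-≤ (m^n>0 2 n) (n<2^n n) ⟩
  2 ^ n + 2 ^ n       ≡⟨ cong (λ w → 2 ^ n + w) (+-identityʳ (2 ^ n)) ⟨
  2 ^ suc n           ∎
  where open ≤-Reasoning

theorem4p3 : ((k h : ℕ) → 2 ≤ k → 1 ≤ h → 2 ^ h ≤ k →
    ((+ k) / 1 ≤ℚ Ŝ (TEP k h))
    × (Ŝ (TEP k h) ≤ℚ ((+ (2 ^ (2 ^ (h ∸ 1) + 1))) / 3) *ℚ ((+ k) / 1)))
    × ((k m : ℕ) → 1 ≤ m → k ≡ 2 ^ (2 ^ m) →
    Ŝ (TEP k m) ≤ℚ (+ (k * k)) / 3)
theorem4p3 = general , loglog
  where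
  general : (k h : ℕ) → 2 ≤ k → 1 ≤ h → 2 ^ h ≤ k →
    ((+ k) / 1 ≤ℚ Ŝ (TEP k h)) × (Ŝ (TEP k h) ≤ℚ upperBound k (h ∸ 1))
  general (suc _) (suc d) _ _ 2^h≤k = Ŝ-TEP-lower d , Ŝ-TEP-upper d 2^h≤k

  loglog : (k m : ℕ) → 1 ≤ m → k ≡ 2 ^ (2 ^ m) → Ŝ (TEP k m) ≤ℚ (+ (k * k)) / 3
  loglog k (suc d) 1≤m k≡ =
    -- With `h = m` the condition `2 ^ h ≤ k` reads `2 ^ m ≤ 2 ^ (2 ^ m)`, which follows from
    -- `n<2^n`.
    ℚ.≤-trans (proj₂ (general k (suc d) (subst (2 ≤_) (sym k≡) (^-monoʳ-≤ 2 (m^n>0 2 (suc d)))) 1≤m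
                (subst (2 ^ suc d ≤_) (sym k≡) (<⇒≤ (n<2^n (2 ^ suc d))))))
              (bound-loglog k d k≡)
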